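{- Let $n\ge 6$ be even and let $\pi$ be a permutation of $[n]=\{1,\dots,n\}$. If $rt(C_n,\pi)=n-1$, then $\pi$ is the rotation $23\cdots n1$ or its inverse; that is, either $\pi(i)\equiv i+1 \pmod n$ for all $i\in[n]$, or $\pi(i)\equiv i-1\pmod n$ for all $i\in[n]$.
   Context: $C_n$ is the cycle with vertices $1,2,\dots,n$ labeled in cyclic order (edges $\{i,i+1\}$, indices mod $n$). For a permutation $\pi$ of $[n]$, a pebble $p_i$ with destination $\pi(i)$ is initially placed at vertex $i$, for each $i\in[n]$. At each step one chooses a matching of $C_n$ and, for every edge of the matching, swaps the two pebbles at its endpoints. $rt(C_n,\pi)$ is the minimum number of steps after which every pebble can be at its destination. Permutations are written in one-line notation $\pi(1)\pi(2)\cdots\pi(n)$. -}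

module Defs where

open import Data.Bool.Base using (if_then_else_)
open import Data.Fin.Base using (Fin; toℕ)
open import Data.Fin.Permutation using (Permutation′; _⟨$⟩ʳ_)
open import Data.Fin.Subset using (Subset; _∈_)
open import Data.Nat.Base using (ℕ; suc; _+_; _≤_)
open import Data.Nat.DivMod using (_mod_)
open import Data.Product.Base using (Σ-syntax; _×_)
open import Data.Sum.Base using (_⊎_)
open import Data.Vec.Base using (Vec; []; _∷_; lookup)
open import Relation.Binary.PropositionalEquality.Core using (_≡_)

private
  variable
    n k : ℕ

-- The vertices 1, …, n of Cₙ are represented by 0, …, n ∸ 1 in Fin n.

next : Fin n → Fin n
next {suc m} i = suc (toℕ i) mod suc m

-- i - 1, written as i + (n - 1) modulo n, where n = suc m.
prev : Fin n → Fin n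
prev {suc m} i = (toℕ i + m) mod suc m

-- For n ≥ 3 the n edges of Cₙ are indexed by Fin n: the index e stands for
-- the edge {e , next e}, so a set of edges is a Subset n.

Incident : Fin n → Fin n → Set
Incident v e = v ≡ e ⊎ v ≡ next e

IsMatching : Subset n → Set
IsMatching {n} M = ∀ (v e f : Fin n) → e ∈ M → f ∈ M →
                   Incident v e → Incident v f → e ≡ f

record Matching (n : ℕ) : Set where
  field
    edges      : Subset n
    isMatching : IsMatching edges

open Matching public

-- The vertex to which the pebble at v is carried when the pebbles at the
-- ends of each edge of M are swapped.  The edges at v are those with
-- indices v and prev v.
move : Matching n → Fin n → Fin n
move M v =
  if lookup (edges M) v then next v
  else if lookup (edges M) (prev v) then prev v
  else v

-- The final vertex of the pebble that starts at v.
route : Vec (Matching n) k → Fin n → Fin n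
route []       v = v
route (M ∷ Ms) v = route Ms (move M v)

RoutableIn : Permutation′ n → ℕ → Set
RoutableIn {n} π k =
  Σ[ Ms ∈ Vec (Matching n) k ] (∀ i → route Ms i ≡ π ⟨$⟩ʳ i)

-- rt(Cₙ , π) = k, as a relation: k is the least number of steps.
rt[_]≡_ : Permutation′ n → ℕ → Set
rt[ π ]≡ k = RoutableIn π k × (∀ j → RoutableIn π j → k ≤ j)

{-# OPTIONS --safe #-}
module Submission where

-- Unroll the cycle to ℤ and lift π to an affine permutation f y = y + D y with
-- total displacement 0 and all displacements within n of each other.  Since n
-- is even, odd-even transposition sort is compatible with the period.  For a
-- cut c and a threshold t let H c t be the number of pebbles y < c with
-- f y ≥ t plus the number of pebbles y ≥ c with f y < t.  One step replaces
-- H c t by max (H (c - 1) t) (H (c + 1) t) - 1 at the compared cuts, and the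
-- line is sorted when H t t = 0 for all t.  Hence n - 2 steps suffice as soon
-- as H c t ≤ n - 2 for |c - t| ≤ n - 2 and all c of one parity.
--
-- If q pebbles pass c from left to right and p from right to left, one of the
-- former travels at least p and one of the latter at most - q, so that H is
-- bounded by the spread of D.  A cut with H c t ≥ n - 1 is therefore almost
-- rigid: next to it there is a run of pebbles of maximal or of minimal
-- displacement.  If the spread is less than n, there is only one such cut
-- modulo n.  If it is n, the pebbles with displacements M and M - n may be
-- interchanged: two such cuts of different parity exist only in one special
-- configuration, which a single interchange destroys, and for the rotations
-- by 2, …, n - 2 the pebbles are chosen by the parity of their vertices.

open import Defs
open import Data.Bool.Base using (Bool; true; false; not; if_then_else_; _∧_; _∨_; T)
open import Data.Bool.Properties using (not-involutive; T-∧)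
open import Data.Empty using (⊥; ⊥-elim)
open import Data.Fin.Base as Fin using (Fin; toℕ)
open import Data.Fin.Permutation using (Permutation′; _⟨$⟩ʳ_; _⟨$⟩ˡ_; inverseˡ; inverseʳ)
import Data.Fin.Properties as Fin
open import Data.Fin.Subset using (_∈_)
open import Data.Integer.Base as ℤ using (ℤ; +_; -[1+_]; 0ℤ; 1ℤ; -1ℤ; _+_; _-_; -_; _*_;
  _≤_; _<_; +≤+; ∣_∣; _⊔_; _⊓_)
import Data.Integer.DivMod as ℤ
import Data.Integer.Properties as ℤ
open import Data.Integer.Tactic.RingSolver using (solve-∀)
open import Data.List.Base as List using (List; []; _∷_; _++_)
open import Data.List.Relation.Unary.All as All using (All; []; _∷_)
open import Data.List.Relation.Unary.All.Properties using (++⁺; map⁺)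
open import Data.Maybe.Base using (Maybe; just; nothing)
open import Data.Nat.Base as ℕ using (ℕ; zero; suc; _∸_)
open import Data.Nat.Divisibility using (_∣_; quotient)
import Data.Nat.DivMod as ℕ
import Data.Nat.Properties as ℕ
open import Data.Product.Base using (∃; _×_; _,_; proj₁; proj₂)
open import Data.Sum.Base using (_⊎_; inj₁; inj₂; [_,_]′)
open import Data.Unit.Base using (tt)
open import Data.Vec.Base as Vec using (Vec; []; _∷_; lookup; tabulate)
open import Data.Vec.Properties using (lookup∘tabulate; []=⇒lookup)
open import Function.Base using (_∘_)
open import Function.Bundles using (Equivalence)
open import Relation.Binary.PropositionalEquality
open import Relation.Nullary using (¬_; Dec; yes; no; does; contradiction)
open import Relation.Nullary.Decidable using (dec-true; dec-false; toSum)

-- Linear arithmetic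

-- The sort may begin in either phase, and a phase fails only because of a cut with H c t ≥ n - 1
-- that its first step leaves alone. So if n - 2 steps never suffice, every lift of total
-- displacement 0 has such cuts in both parities, and it is enough to exhibit one lift for which
-- this is absurd.
--
-- A lift is a set `b` of vertices, those whose pebbles run against the direction of `next`. Sending
-- the pebbles with the longest forward distance backwards keeps the spread at most n. Inside the
-- window H can then exceed n - 2 only by taking the values n - 1 and n, and this slack of one is
-- why the displacements around such a cut are almost forced.
--
-- The analysis of cuts is carried out for abstract `System`s rather than for lifts: the mirror
-- image of a `System` is again one, so a statement about one side of a cut yields the statement
-- about the other side without reflecting the permutation itself.

module LinearArithmetic where

  private
    variable
      k : ℕ

  record Form (k : ℕ) : Set where
    constructor form
    field
      constant : ℤ
      coefficients : Vec ℤ k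

  _•_ : Vec ℤ k → Vec ℤ k → ℤ
  [] • [] = 0ℤ
  (a ∷ as) • (x ∷ xs) = a * x + as • xs

  value : Vec ℤ k → Form k → ℤ
  value ρ (form c as) = c + as • ρ

  combine : ℤ → Form k → ℤ → Form k → Form k
  combine m (form c as) n (form d bs) =
    form (m * c + n * d) (Vec.zipWith (λ a b → m * a + n * b) as bs)

  •-combine : ∀ m n (as bs ρ : Vec ℤ k) →
    Vec.zipWith (λ a b → m * a + n * b) as bs • ρ ≡ m * (as • ρ) + n * (bs • ρ)
  •-combine m n [] [] [] = lem m n
    where
    lem : ∀ m n → 0ℤ ≡ m * 0ℤ + n * 0ℤ
    lem = solve-∀
  •-combine m n (a ∷ as) (b ∷ bs) (x ∷ ρ) rewrite •-combine m n as bs ρ =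
    lem m n a b x (as • ρ) (bs • ρ)
    where
    lem : ∀ m n a b x u v →
      (m * a + n * b) * x + (m * u + n * v) ≡ m * (a * x + u) + n * (b * x + v)
    lem = solve-∀

  value-combine : ∀ (ρ : Vec ℤ k) m u n v →
    value ρ (combine m u n v) ≡ m * value ρ u + n * value ρ v
  value-combine ρ m (form c as) n (form d bs) rewrite •-combine m n as bs ρ =
    lem m n c d (as • ρ) (bs • ρ)
    where
    lem : ∀ m n c d u v →
      m * c + n * d + (m * u + n * v) ≡ m * (c + u) + n * (d + v)
    lem = solve-∀

  Zero NonNeg : Vec ℤ k → Form k → Set
  Zero ρ u = value ρ u ≡ 0ℤ
  NonNeg ρ u = 0ℤ ≤ value ρ u

  combine-zero : ∀ (ρ : Vec ℤ k) m {u} n {v} → Zero ρ u → Zero ρ v → Zero ρ (combine m u n v)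
  combine-zero ρ m {u} n {v} p q = trans (value-combine ρ m u n v)
    (trans (cong₂ (λ x y → m * x + n * y) p q) (lem m n))
    where
    lem : ∀ m n → m * 0ℤ + n * 0ℤ ≡ 0ℤ
    lem = solve-∀

  *-nonNeg : ∀ m {x} → 0ℤ ≤ x → 0ℤ ≤ + m * x
  *-nonNeg m {x} p = subst (_≤ + m * x) (ℤ.*-zeroʳ (+ m)) (ℤ.*-monoˡ-≤-nonNeg (+ m) p)

  combine-nonNeg : ∀ (ρ : Vec ℤ k) m {u} n {v} →
    NonNeg ρ u → NonNeg ρ v → NonNeg ρ (combine (+ m) u (+ n) v)
  combine-nonNeg ρ m {u} n {v} p q = subst (0ℤ ≤_) (sym (value-combine ρ (+ m) u (+ n) v))
    (ℤ.+-mono-≤ (*-nonNeg m p) (*-nonNeg n q))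

  combine-zero-nonNeg : ∀ (ρ : Vec ℤ k) m {u} n {v} →
    Zero ρ u → NonNeg ρ v → NonNeg ρ (combine m u (+ n) v)
  combine-zero-nonNeg ρ m {u} n {v} p q = subst (0ℤ ≤_)
    (sym (trans (value-combine ρ m u (+ n) v)
      (trans (cong (λ x → m * x + + n * value ρ v) p) (lem m (+ n * value ρ v)))))
    (*-nonNeg n q)
    where
    lem : ∀ m y → m * 0ℤ + y ≡ y
    lem = solve-∀

  head : Form (suc k) → ℤ
  head (form _ (a ∷ _)) = a

  tail : Form (suc k) → Form k
  tail (form c (_ ∷ as)) = form c as

  value-tail : ∀ x (ρ : Vec ℤ k) u → head u ≡ 0ℤ → value (x ∷ ρ) u ≡ value ρ (tail u)
  value-tail x ρ (form c (_ ∷ as)) refl = lem c x (as • ρ)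
    where
    lem : ∀ c x u → c + (0ℤ * x + u) ≡ c + u
    lem = solve-∀

  -- The combination of u and v in which the first variable cancels, when
  -- that is possible with a non-negative multiple of v (and of u, if it is
  -- only known to be non-negative).
  cancel= : Form (suc k) → Form (suc k) → Form (suc k)
  cancel= u v with head u
  ... | + m = combine (- head v) u (+ m) v
  ... | -[1+ m ] = combine (head v) u (+ suc m) v

  cancel=-zero : ∀ (ρ : Vec ℤ (suc k)) u v → Zero ρ u → Zero ρ v → Zero ρ (cancel= u v)
  cancel=-zero ρ u v p q with head u
  ... | + m = combine-zero ρ (- head v) {u} (+ m) {v} p q
  ... | -[1+ m ] = combine-zero ρ (head v) {u} (+ suc m) {v} p q

  cancel=-nonNeg : ∀ (ρ : Vec ℤ (suc k)) u v → Zero ρ u → NonNeg ρ v → NonNeg ρ (cancel= u v)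
  cancel=-nonNeg ρ u v p q with head u
  ... | + m = combine-zero-nonNeg ρ (- head v) {u} m {v} p q
  ... | -[1+ m ] = combine-zero-nonNeg ρ (head v) {u} (suc m) {v} p q

  -- Dropping the forms in which the first variable survives only weakens the hypotheses, so
  -- soundness does not rest on `cancel=` and `cross` really cancelling it.
  keep : List (Form (suc k)) → List (Form k)
  keep [] = []
  keep (u ∷ us) with head u
  ... | + 0 = tail u ∷ keep us
  ... | _ = keep us

  All-keep : ∀ {P : ℤ → Set} x (ρ : Vec ℤ k) us →
    All (P ∘ value (x ∷ ρ)) us → All (P ∘ value ρ) (keep us)
  All-keep x ρ [] [] = []
  All-keep {P = P} x ρ (u ∷ us) (p ∷ ps) with head u in eq
  ... | + 0 = subst P (value-tail x ρ u eq) p ∷ All-keep {P = P} x ρ us ps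
  ... | + suc _ = All-keep {P = P} x ρ us ps
  ... | -[1+ _ ] = All-keep {P = P} x ρ us ps

  cross : Form (suc k) → List (Form (suc k)) → List (Form (suc k))
  cross u [] = []
  cross u (v ∷ vs) with head u | head v
  ... | + suc m | -[1+ l ] = combine (+ suc l) u (+ suc m) v ∷ cross u vs
  ... | _ | _ = cross u vs

  cross-nonNeg : ∀ (ρ : Vec ℤ (suc k)) u vs → NonNeg ρ u →
    All (NonNeg ρ) vs → All (NonNeg ρ) (cross u vs)
  cross-nonNeg ρ u [] p [] = []
  cross-nonNeg ρ u (v ∷ vs) p (q ∷ qs) with head u | head v
  ... | + suc m | -[1+ l ] =
    combine-nonNeg ρ (suc l) {u} (suc m) {v} p q ∷ cross-nonNeg ρ u vs p qs
  ... | + suc m | + _ = cross-nonNeg ρ u vs p qs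
  ... | + 0 | _ = cross-nonNeg ρ u vs p qs
  ... | -[1+ _ ] | _ = cross-nonNeg ρ u vs p qs

  crosses : List (Form (suc k)) → List (Form (suc k)) → List (Form (suc k))
  crosses [] vs = []
  crosses (u ∷ us) vs = cross u vs ++ crosses us vs

  crosses-nonNeg : ∀ (ρ : Vec ℤ (suc k)) us vs → All (NonNeg ρ) us →
    All (NonNeg ρ) vs → All (NonNeg ρ) (crosses us vs)
  crosses-nonNeg ρ [] vs [] qs = []
  crosses-nonNeg ρ (u ∷ us) vs (p ∷ ps) qs =
    ++⁺ (cross-nonNeg ρ u vs p qs) (crosses-nonNeg ρ us vs ps qs)

  pivot : List (Form (suc k)) → Maybe (Form (suc k))
  pivot [] = nothing
  pivot (u ∷ us) with head u
  ... | + 0 = pivot us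
  ... | _ = just u

  pivot-zero : ∀ (ρ : Vec ℤ (suc k)) us → All (Zero ρ) us → ∀ {u} → pivot us ≡ just u → Zero ρ u
  pivot-zero ρ (u ∷ us) (p ∷ ps) eq with head u
  ... | + 0 = pivot-zero ρ us ps eq
  pivot-zero ρ (u ∷ us) (p ∷ ps) refl | + suc _ = p
  pivot-zero ρ (u ∷ us) (p ∷ ps) refl | -[1+ _ ] = p

  nonZero negative : Form 0 → Bool
  nonZero (form (+ 0) _) = false
  nonZero (form _ _) = true
  negative (form -[1+ _ ] _) = true
  negative (form (+ _) _) = false

  anyᵇ : (Form 0 → Bool) → List (Form 0) → Bool
  anyᵇ p [] = false
  anyᵇ p (u ∷ us) = p u ∨ anyᵇ p us

  -- Gaussian elimination with the equations us as long as possible, then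
  -- Fourier–Motzkin elimination with the inequalities vs.
  refutes : ∀ k → List (Form k) → List (Form k) → Bool
  refutes zero us vs = anyᵇ nonZero us ∨ anyᵇ negative vs
  refutes (suc k) us vs with pivot us
  ... | just u = refutes k (keep (List.map (cancel= u) us)) (keep (List.map (cancel= u) vs))
  ... | nothing = refutes k (keep us) (keep vs ++ keep (crosses vs vs))

  anyᵇ-absurd : ∀ {P : Form 0 → Set} p → (∀ u → T (p u) → ¬ P u) →
    ∀ us → T (anyᵇ p us) → ¬ All P us
  anyᵇ-absurd p absurd (u ∷ us) t (q ∷ qs) with p u in eq
  ... | true = absurd u (subst T (sym eq) tt) q
  ... | false = anyᵇ-absurd p absurd us t qs

  nonZero-absurd : ∀ u → T (nonZero u) → ¬ Zero [] u
  nonZero-absurd (form (+ suc _) []) t ()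
  nonZero-absurd (form -[1+ _ ] []) t ()

  negative-absurd : ∀ u → T (negative u) → ¬ NonNeg [] u
  negative-absurd (form -[1+ _ ] []) t ()

  refutes-sound : ∀ k (ρ : Vec ℤ k) us vs → T (refutes k us vs) →
    All (Zero ρ) us → ¬ All (NonNeg ρ) vs
  refutes-sound zero [] us vs t ps qs with anyᵇ nonZero us in eq
  ... | true = anyᵇ-absurd nonZero nonZero-absurd us (subst T (sym eq) tt) ps
  ... | false = anyᵇ-absurd negative negative-absurd vs t qs
  refutes-sound (suc k) (x ∷ ρ) us vs t ps qs with pivot us in eq
  ... | just u = let z = pivot-zero (x ∷ ρ) us ps eq in
    refutes-sound k ρ _ _ t
      (All-keep {P = _≡ 0ℤ} x ρ _ (map⁺ (All.map (λ {v} → cancel=-zero (x ∷ ρ) u v z) ps)))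
      (All-keep {P = 0ℤ ≤_} x ρ _ (map⁺ (All.map (λ {v} → cancel=-nonNeg (x ∷ ρ) u v z) qs)))
  ... | nothing = refutes-sound k ρ _ _ t
    (All-keep {P = _≡ 0ℤ} x ρ _ ps)
    (++⁺ (All-keep {P = 0ℤ ≤_} x ρ _ qs)
         (All-keep {P = 0ℤ ≤_} x ρ _ (crosses-nonNeg (x ∷ ρ) vs vs qs qs)))

  -- Syntax and reflection of linear problems

  infix 8 :-_
  infixl 6 _:+_ _:-_
  infix 4 _:≤_ _:<_ _:≡_
  infixr 3 _⇒_

  data Expr (k : ℕ) : Set where
    ν : Fin k → Expr k
    # : ℕ → Expr k
    :-_ : Expr k → Expr k
    _:+_ _:-_ : Expr k → Expr k → Expr k

  ⟦_⟧ : Expr k → Vec ℤ k → ℤ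
  ⟦ ν i ⟧ ρ = lookup ρ i
  ⟦ # m ⟧ ρ = + m
  ⟦ :- e ⟧ ρ = - ⟦ e ⟧ ρ
  ⟦ e :+ e′ ⟧ ρ = ⟦ e ⟧ ρ + ⟦ e′ ⟧ ρ
  ⟦ e :- e′ ⟧ ρ = ⟦ e ⟧ ρ - ⟦ e′ ⟧ ρ

  data Atom (k : ℕ) : Set where
    _:≤_ _:<_ _:≡_ : Expr k → Expr k → Atom k
    absurd : Atom k

  data Problem (k : ℕ) : Set where
    _⇒_ : Atom k → Problem k → Problem k
    goal : Atom k → Problem k

  ⟦_⟧ᵃ : Atom k → Vec ℤ k → Set
  ⟦ e :≤ e′ ⟧ᵃ ρ = ⟦ e ⟧ ρ ≤ ⟦ e′ ⟧ ρ
  ⟦ e :< e′ ⟧ᵃ ρ = ⟦ e ⟧ ρ < ⟦ e′ ⟧ ρ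
  ⟦ e :≡ e′ ⟧ᵃ ρ = ⟦ e ⟧ ρ ≡ ⟦ e′ ⟧ ρ
  ⟦ absurd ⟧ᵃ ρ = ⊥

  ⟦_⟧ᵖ : Problem k → Vec ℤ k → Set
  ⟦ a ⇒ p ⟧ᵖ ρ = ⟦ a ⟧ᵃ ρ → ⟦ p ⟧ᵖ ρ
  ⟦ goal a ⟧ᵖ ρ = ⟦ a ⟧ᵃ ρ

  unit : Fin k → Vec ℤ k
  unit {suc k} Fin.zero = 1ℤ ∷ Vec.replicate k 0ℤ
  unit (Fin.suc i) = 0ℤ ∷ unit i

  linear : Expr k → Form k
  linear (ν i) = form 0ℤ (unit i)
  linear {k} (# m) = form (+ m) (Vec.replicate k 0ℤ)
  linear (:- e) = combine -1ℤ (linear e) 0ℤ (linear e)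
  linear (e :+ e′) = combine 1ℤ (linear e) 1ℤ (linear e′)
  linear (e :- e′) = combine 1ℤ (linear e) -1ℤ (linear e′)

  zero-• : ∀ (ρ : Vec ℤ k) → Vec.replicate k 0ℤ • ρ ≡ 0ℤ
  zero-• [] = refl
  zero-• (x ∷ ρ) rewrite zero-• ρ = lem x
    where
    lem : ∀ x → 0ℤ * x + 0ℤ ≡ 0ℤ
    lem = solve-∀

  unit-• : ∀ i (ρ : Vec ℤ k) → unit i • ρ ≡ lookup ρ i
  unit-• Fin.zero (x ∷ ρ) rewrite zero-• ρ = lem x
    where
    lem : ∀ x → 1ℤ * x + 0ℤ ≡ x
    lem = solve-∀
  unit-• (Fin.suc i) (x ∷ ρ) rewrite unit-• i ρ = lem x (lookup ρ i)
    where
    lem : ∀ x y → 0ℤ * x + y ≡ y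
    lem = solve-∀

  value-linear : ∀ e (ρ : Vec ℤ k) → value ρ (linear e) ≡ ⟦ e ⟧ ρ
  value-linear (ν i) ρ = trans (ℤ.+-identityˡ _) (unit-• i ρ)
  value-linear (# m) ρ = trans (cong (_+_ (+ m)) (zero-• ρ)) (ℤ.+-identityʳ (+ m))
  value-linear (:- e) ρ = trans (value-combine ρ -1ℤ (linear e) 0ℤ (linear e))
    (trans (cong (λ x → -1ℤ * x + 0ℤ * x) (value-linear e ρ)) (lem (⟦ e ⟧ ρ)))
    where
    lem : ∀ x → -1ℤ * x + 0ℤ * x ≡ - x
    lem = solve-∀
  value-linear (e :+ e′) ρ = trans (value-combine ρ 1ℤ (linear e) 1ℤ (linear e′))
    (trans (cong₂ (λ x y → 1ℤ * x + 1ℤ * y) (value-linear e ρ) (value-linear e′ ρ))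
      (cong₂ _+_ (ℤ.*-identityˡ (⟦ e ⟧ ρ)) (ℤ.*-identityˡ (⟦ e′ ⟧ ρ))))
  value-linear (e :- e′) ρ = trans (value-combine ρ 1ℤ (linear e) -1ℤ (linear e′))
    (trans (cong₂ (λ x y → 1ℤ * x + -1ℤ * y) (value-linear e ρ) (value-linear e′ ρ))
      (cong₂ _+_ (ℤ.*-identityˡ (⟦ e ⟧ ρ)) (ℤ.-1*i≡-i (⟦ e′ ⟧ ρ))))

  equations inequalities : Atom k → List (Form k) → List (Form k)
  equations (e :≡ e′) us = linear (e′ :- e) ∷ us
  equations _ us = us
  inequalities (e :≤ e′) vs = linear (e′ :- e) ∷ vs
  inequalities (e :< e′) vs = linear (e′ :- (# 1 :+ e)) ∷ vs
  inequalities _ vs = vs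

  -- The negated goal joins the hypotheses. Integrality enters only through `inequalities`, where a
  -- strict inequality is tightened by 1; everything else is reasoning over ordered fields.
  refutable : List (Form k) → List (Form k) → Problem k → Bool
  refutable us vs (a ⇒ p) = refutable (equations a us) (inequalities a vs) p
  refutable us vs (goal (e :≤ e′)) = refutes _ us (inequalities (e′ :< e) vs)
  refutable us vs (goal (e :< e′)) = refutes _ us (inequalities (e′ :≤ e) vs)
  refutable us vs (goal (e :≡ e′)) =
    refutes _ us (inequalities (e′ :< e) vs) ∧ refutes _ us (inequalities (e :< e′) vs)
  refutable us vs (goal absurd) = refutes _ us vs

  equations-zero : ∀ a (ρ : Vec ℤ k) {us} → ⟦ a ⟧ᵃ ρ → All (Zero ρ) us → All (Zero ρ) (equations a us)
  equations-zero (e :≤ e′) ρ h ps = ps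
  equations-zero (e :< e′) ρ h ps = ps
  equations-zero (e :≡ e′) ρ h ps =
    trans (value-linear (e′ :- e) ρ) (ℤ.i≡j⇒i-j≡0 (sym h)) ∷ ps

  inequalities-nonNeg : ∀ a (ρ : Vec ℤ k) {vs} → ⟦ a ⟧ᵃ ρ → All (NonNeg ρ) vs →
    All (NonNeg ρ) (inequalities a vs)
  inequalities-nonNeg (e :≤ e′) ρ h qs =
    subst (0ℤ ≤_) (sym (value-linear (e′ :- e) ρ)) (ℤ.i≤j⇒0≤j-i h) ∷ qs
  inequalities-nonNeg (e :< e′) ρ h qs =
    subst (0ℤ ≤_) (sym (value-linear (e′ :- (# 1 :+ e)) ρ))
      (ℤ.i≤j⇒0≤j-i (ℤ.i<j⇒suc[i]≤j h)) ∷ qs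
  inequalities-nonNeg (e :≡ e′) ρ h qs = qs

  refutable-sound : ∀ (ρ : Vec ℤ k) {us vs} p → T (refutable us vs p) →
    All (Zero ρ) us → All (NonNeg ρ) vs → ⟦ p ⟧ᵖ ρ
  refutable-sound ρ (a ⇒ p) t ps qs h =
    refutable-sound ρ p t (equations-zero a ρ h ps) (inequalities-nonNeg a ρ h qs)
  refutable-sound ρ {us} {vs} (goal (e :≤ e′)) t ps qs with ⟦ e ⟧ ρ ℤ.≤? ⟦ e′ ⟧ ρ
  ... | yes h = h
  ... | no h = ⊥-elim (refutes-sound _ ρ us _ t ps
    (inequalities-nonNeg (e′ :< e) ρ (ℤ.≰⇒> h) qs))
  refutable-sound ρ {us} {vs} (goal (e :< e′)) t ps qs with ⟦ e ⟧ ρ ℤ.<? ⟦ e′ ⟧ ρ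
  ... | yes h = h
  ... | no h = ⊥-elim (refutes-sound _ ρ us _ t ps
    (inequalities-nonNeg (e′ :≤ e) ρ (ℤ.≮⇒≥ h) qs))
  refutable-sound ρ {us} {vs} (goal (e :≡ e′)) t ps qs =
    let t₁ , t₂ = Equivalence.to T-∧ t in
    ℤ.≤-antisym (refutable-sound ρ {us} {vs} (goal (e :≤ e′)) t₁ ps qs)
                (refutable-sound ρ {us} {vs} (goal (e′ :≤ e)) t₂ ps qs)
  refutable-sound ρ {us} {vs} (goal absurd) t ps qs = refutes-sound _ ρ us vs t ps qs

  Curried : ∀ k → (Vec ℤ k → Set) → Set
  Curried zero P = P []
  Curried (suc k) P = ∀ x → Curried k (P ∘ (x ∷_))

  curried : ∀ k {P : Vec ℤ k → Set} → (∀ ρ → P ρ) → Curried k P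
  curried zero f = f []
  curried (suc k) f x = curried k (f ∘ (x ∷_))

  Nary : ℕ → Set → Set → Set
  Nary zero A B = B
  Nary (suc k) A B = A → Nary k A B

  apply : ∀ {k A B} → Nary k A B → Vec A k → B
  apply f [] = f
  apply f (x ∷ xs) = apply (f x) xs

  problem : ∀ k → Nary k (Expr k) (Problem k) → Problem k
  problem k f = apply f (tabulate ν)

  -- Unfolding the soundness proof in with-abstractions would be too expensive.
  abstract
    lia : ∀ k (f : Nary k (Expr k) (Problem k)) {_ : T (refutable [] [] (problem k f))} →
      Curried k ⟦ problem k f ⟧ᵖ
    lia k f {t} = curried k (λ ρ → refutable-sound ρ (problem k f) t [] [])

open LinearArithmetic using (lia; :-_; _:+_; _:-_; #; _:≤_; _:<_; _:≡_; absurd; _⇒_; goal)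

+∣-∣ : ∀ {c x} → c ≤ x → x ≡ c + + ∣ x - c ∣
+∣-∣ {c} {x} c≤x rewrite ℤ.0≤i⇒+∣i∣≡i (ℤ.i≤j⇒0≤j-i c≤x) = lia 2 (λ c x → goal (x :≡ c :+ (x :- c))) c x

ascend : ∀ {P : ℤ → Set} c → P c → (∀ x → c ≤ x → P x → P (x + + 1)) → ∀ x → c ≤ x → P x
ascend {P} c base step x c≤x = subst P (sym (+∣-∣ c≤x)) (go ∣ x - c ∣)
  where
  go : ∀ k → P (c + + k)
  go zero = subst P (sym (ℤ.+-identityʳ c)) base
  go (suc k) = subst P
    (trans (ℤ.+-assoc c (+ k) (+ 1)) (cong (λ i → c + + i) (ℕ.+-comm k 1)))
    (step (c + + k) (ℤ.i≤i+j c (+ k)) (go k))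

descend : ∀ {P : ℤ → Set} c → P c → (∀ x → x < c → P (x + + 1) → P x) → ∀ x → x ≤ c → P x
descend {P} c base step x x≤c = subst P (lia 2 (λ c x → goal (c :- (c :- x) :≡ x)) c x)
  (ascend {λ u → P (c - u)} (+ 0) (subst P (sym (ℤ.+-identityʳ c)) base)
    (λ u 0≤u p → step (c - (u + + 1))
      (lia 2 (λ c u → # 0 :≤ u ⇒ goal (c :- (u :+ # 1) :< c)) c u 0≤u)
      (subst P (lia 2 (λ c u → goal (c :- u :≡ c :- (u :+ # 1) :+ # 1)) c u) p))
    (c - x) (lia 2 (λ c x → x :≤ c ⇒ goal (# 0 :≤ c :- x)) c x x≤c))

-- The static analysis of lifts

module Residues (n : ℕ) .{{_ : ℕ.NonZero n}} where

  N : ℤ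
  N = + n

  infix 4 _∼_

  record _∼_ (x y : ℤ) : Set where
    constructor multiple
    field
      factor : ℤ
      equation : x ≡ y + factor * N

  ∼-shift : ∀ {x y} z → x ∼ y → x + z ∼ y + z
  ∼-shift {x} {y} z (multiple k refl) = multiple k
    (lia 3 (λ y k z → goal (y :+ k :+ z :≡ y :+ z :+ k)) y (k * N) z)

  ∼-sym : ∀ {x y} → x ∼ y → y ∼ x
  ∼-sym {x} {y} (multiple k refl) = multiple (- k) (lem y k N)
    where
    lem : ∀ y k N → y ≡ y + k * N + - k * N
    lem = solve-∀

  ∼-trans : ∀ {x y z} → x ∼ y → y ∼ z → x ∼ z
  ∼-trans {z = z} (multiple k refl) (multiple l refl) = multiple (l + k) (lem z k l N)
    where
    lem : ∀ z k l N → z + l * N + k * N ≡ z + (l + k) * N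
    lem = solve-∀

  periodic⇒∼ : ∀ {A : Set} (g : ℤ → A) → (∀ x → g (x + N) ≡ g x) → ∀ {x y} → x ∼ y → g x ≡ g y
  periodic⇒∼ g periodic {x} {y} (multiple k refl) = go y k
    where
    up : ∀ m y → g (y + + m * N) ≡ g y
    up zero y = cong g (ℤ.+-identityʳ y)
    up (suc m) y = trans (cong g (lem y (+ m) N)) (trans (periodic _) (up m y))
      where
      lem : ∀ y m N → y + (+ 1 + m) * N ≡ y + m * N + N
      lem = solve-∀
    go : ∀ y k → g (y + k * N) ≡ g y
    go y (+ m) = up m y
    go y k@(-[1+ m ]) = trans (sym (up (suc m) (y + k * N))) (cong g (lem y (+ suc m) N))
      where
      lem : ∀ y m N → y + - m * N + m * N ≡ y
      lem = solve-∀

  window : ∀ c x → ∃ λ y → c ≤ y × y < c + N × x ∼ y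
  window c x = c + + r , ℤ.i≤i+j c (+ r) , ℤ.+-monoʳ-< c (ℤ.+<+ (ℤ.n%ℕd<d (x - c) n)) ,
    multiple ((x - c) ℤ./ℕ n) (lia 4 (λ c x r k → x :- c :≡ r :+ k ⇒ goal (x :≡ c :+ r :+ k)) c x (+ r) _
      (ℤ.a≡a%ℕn+[a/ℕn]*n (x - c) n))
    where r = (x - c) ℤ.%ℕ n

  -- A pebble at y has to travel D y, so f is an affine permutation.  R c t
  -- counts the y < c with t ≤ f y, and R c t - (c - t) the y ≥ c with f y < t.
  record System : Set where
    field
      D : ℤ → ℤ
      R : ℤ → ℤ → ℤ
    f : ℤ → ℤ
    f y = y + D y
    field
      periodic : ∀ y → D (y + N) ≡ D y
      injective : ∀ x y → f x ≡ f y → x ≡ y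
      above : ∀ c t → t ≤ f c → R (c + + 1) t ≡ R c t + + 1
      below : ∀ c t → f c < t → R (c + + 1) t ≡ R c t
      R≥0 : ∀ c t → + 0 ≤ R c t
      R≥c-t : ∀ c t → c - t ≤ R c t
      R-antitone : ∀ c t → R c (t + + 1) ≤ R c t
      R-slow : ∀ c t → R c t ≤ R c (t + + 1) + + 1
      existsAbove : ∀ c t → + 0 < R c t → ∃ λ y → y < c × t ≤ f y
      existsBelow : ∀ c t → c - t < R c t → ∃ λ z → c ≤ z × f z < t

    D-∼ : ∀ {x y} → x ∼ y → D x ≡ D y
    D-∼ = periodic⇒∼ D periodic

    D-back : ∀ x → D (x - N) ≡ D x
    D-back x = trans (sym (periodic (x - N))) (cong D (lia 2 (λ x N → goal (x :- N :+ N :≡ x)) x N))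

    -- At the cut c, for a suitable t, q pebbles have to move from left to right
    -- and p from right to left, so that H c t = p + q.
    Tight : ℤ → ℤ → ℤ → Set
    Tight c p q = R c (c + p - q) ≡ q

    R-mono : ∀ t {c c′} → c ≤ c′ → R c t ≤ R c′ t
    R-mono t {c} {c′} = ascend {λ x → R c t ≤ R x t} c ℤ.≤-refl step c′
      where
      step : ∀ x → c ≤ x → R c t ≤ R x t → R c t ≤ R (x + + 1) t
      step x _ h with t ℤ.≤? f x
      ... | yes t≤ = ℤ.≤-trans h (subst (R x t ≤_) (sym (above x t t≤)) (ℤ.i≤i+j (R x t) (+ 1)))
      ... | no t≰ = ℤ.≤-trans h (ℤ.≤-reflexive (sym (below x t (ℤ.≰⇒> t≰))))

    R-lip : ∀ t {c c′} → c ≤ c′ → R c′ t ≤ R c t + (c′ - c)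
    R-lip t {c} {c′} = ascend {λ x → R x t ≤ R c t + (x - c)} c
      (lia 2 (λ r c → goal (r :≤ r :+ (c :- c))) (R c t) c) step c′
      where
      step : ∀ x → c ≤ x → R x t ≤ R c t + (x - c) → R (x + + 1) t ≤ R c t + (x + + 1 - c)
      step x _ h with t ℤ.≤? f x
      ... | yes t≤ = lia 5
        (λ r′ r s x c → r′ :≡ r :+ # 1 ⇒ r :≤ s :+ (x :- c) ⇒ goal (r′ :≤ s :+ (x :+ # 1 :- c)))
        (R (x + + 1) t) (R x t) (R c t) x c (above x t t≤) h
      ... | no t≰ = lia 5 (λ r′ r s x c → r′ :≡ r ⇒ r :≤ s :+ (x :- c) ⇒ goal (r′ :≤ s :+ (x :+ # 1 :- c)))
        (R (x + + 1) t) (R x t) (R c t) x c (below x t (ℤ.≰⇒> t≰)) h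

    R-slow⁺ : ∀ c {t t′} → t ≤ t′ → R c t ≤ R c t′ + (t′ - t)
    R-slow⁺ c {t} {t′} = ascend {λ x → R c t ≤ R c x + (x - t)} t
      (lia 2 (λ r c → goal (r :≤ r :+ (c :- c))) (R c t) t)
      (λ x _ h → lia 5 (λ r r′ r″ x t → r :≤ r′ :+ (x :- t) ⇒ r′ :≤ r″ :+ # 1 ⇒
        goal (r :≤ r″ :+ (x :+ # 1 :- t)))
        (R c t) (R c x) (R c (x + + 1)) x t h (R-slow c x)) t′

    R-two-above : ∀ t {c x y c′} → c ≤ x → x < y → y < c′ → t ≤ f x → t ≤ f y → R c t + + 2 ≤ R c′ t
    R-two-above t {c} {x} {y} {c′} c≤x x<y y<c′ t≤x t≤y =
      lia 6 (λ a b b′ d d′ e → a :≤ b ⇒ b′ :≡ b :+ # 1 ⇒ b′ :≤ d ⇒ d′ :≡ d :+ # 1 ⇒ d′ :≤ e ⇒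
        goal (a :+ # 2 :≤ e))
        (R c t) (R x t) (R (x + + 1) t) (R y t) (R (y + + 1) t) (R c′ t)
        (R-mono t c≤x) (above x t t≤x)
        (R-mono t (lia 2 (λ x y → x :< y ⇒ goal (x :+ # 1 :≤ y)) x y x<y))
        (above y t t≤y)
        (R-mono t (lia 2 (λ x y → x :< y ⇒ goal (x :+ # 1 :≤ y)) y c′ y<c′))

    -- Going a steps left and b steps up changes R by at most a + b.  With
    -- a + b = R c t - 1 this yields a pebble travelling at least p, for each a.
    displaced : ∀ c t a b → + 0 ≤ a → + 0 ≤ b → a + b < R c t →
      ∃ λ y → y + a < c × t + b ≤ f y
    displaced c t a b 0≤a 0≤b a+b<R
      with existsAbove (c - a) (t + b)
        (lia 7 (λ c t a b r₀ r₁ r₂ → a :+ b :< r₀ ⇒ r₀ :≤ r₁ :+ (c :- (c :- a)) ⇒ r₁ :≤ r₂ :+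
                 (t :+ b :- t) ⇒
                 goal (# 0 :< r₂)) c t a b (R c t) (R (c - a) t) (R (c - a) (t + b))
          a+b<R (R-lip t (lia 2 (λ c a → # 0 :≤ a ⇒ goal (c :- a :≤ c)) c a 0≤a))
          (R-slow⁺ (c - a) (lia 2 (λ t b → # 0 :≤ b ⇒ goal (t :≤ t :+ b)) t b 0≤b)))
    ... | y , y<c-a , t+b≤fy = y , lia 3 (λ y c a → y :< c :- a ⇒ goal (y :+ a :< c)) y c a y<c-a , t+b≤fy

    -- The q pebbles that pass to the right have distinct destinations from c + p - q on, so one of
    -- them must reach c + p - 1, and it starts at c - 1 or earlier.
    exists-left : ∀ {c p q} → Tight c p q → + 0 < q → ∃ λ y → p ≤ D y
    exists-left {c} {p} {q} tight 0<q
      with displaced c (c + p - q) (+ 0) (q - + 1) (+≤+ ℕ.z≤n)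
        (lia 1 (λ q → # 0 :< q ⇒ goal (# 0 :≤ q :- # 1)) q 0<q)
        (subst (+ 0 + (q - + 1) <_) (sym tight) (lia 1 (λ q → goal (# 0 :+ (q :- # 1) :< q)) q))
    ... | y , y< , ≤f = y , lia 5
      (λ c p q y d → y :+ # 0 :< c ⇒ c :+ p :- q :+ (q :- # 1) :≤ y :+ d ⇒ goal (p :≤ d))
      c p q y (D y) y< ≤f

    -- `displaced` with a + b = q - 1 and a = c - 1 - x finds some y ≤ x with x + p ≤ f y. A
    -- displacement of at most p leaves only y = x.
    run-left : ∀ {c p q} → Tight c p q → (∀ y → D y ≤ p) → ∀ x → c - q ≤ x → x < c → D x ≡ p
    run-left {c} {p} {q} tight D≤p x c-q≤x x<c
      with displaced c (c + p - q) (c - + 1 - x) (q - c + x)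
        (lia 2 (λ c x → x :< c ⇒ goal (# 0 :≤ c :- # 1 :- x)) c x x<c)
        (lia 3 (λ c q x → c :- q :≤ x ⇒ goal (# 0 :≤ q :- c :+ x)) c q x c-q≤x)
        (subst (c - + 1 - x + (q - c + x) <_) (sym tight)
          (lia 3 (λ c q x → goal (c :- # 1 :- x :+ (q :- c :+ x) :< q)) c q x))
    ... | y , y< , ≤f with y ℤ.≟ x
    ... | yes refl = ℤ.≤-antisym (D≤p y)
      (lia 5 (λ c p q y d → c :+ p :- q :+ (q :- c :+ y) :≤ y :+ d ⇒ goal (p :≤ d)) c p q y (D y) ≤f)
    ... | no y≢x = contradiction
      (lia 6 (λ c p q y x d → y :+ (c :- # 1 :- x) :< c ⇒ c :+ p :- q :+ (q :- c :+ x) :≤ y :+ d ⇒ d :≤ p ⇒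
        goal (y :≡ x))
        c p q y x (D y) y< ≤f (D≤p y)) y≢x

  -- The reflection y ↦ -1 - y of the line exchanges the two directions.
  reflect : System → System
  reflect S = record
    { D = λ y → - D (-1ℤ - y)
    -- The pebbles that pass c to the right in the mirror image are those at z ≥ - c with f z < - t,
    -- and this is their number.
    ; R = λ c t → R (- c) (- t) + (c - t)
    ; periodic = λ y → cong -_
      (trans (cong D (lia 2 (λ y N → goal (:- # 1 :- (y :+ N) :≡ :- # 1 :- y :- N)) y N))
      (D-back (-1ℤ - y)))
    ; injective = λ x y eq → lia 2 (λ x y → :- # 1 :- x :≡ :- # 1 :- y ⇒ goal (x :≡ y)) x y
        (injective (-1ℤ - x) (-1ℤ - y)
          (lia 4 (λ x y d e → x :+ :- d :≡ y :+ :- e ⇒ goal (:- # 1 :- x :+ d :≡ :- # 1 :- y :+ e))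
            x y (D (-1ℤ - x)) (D (-1ℤ - y)) eq))
    ; above = λ c t h → lia 4 (λ r r′ c t → r :≡ r′ ⇒ goal (r′ :+ (c :+ # 1 :- t) :≡ r :+ (c :- t) :+ # 1))
        (R (- c) (- t)) (R (- (c + + 1)) (- t)) c t
        (subst₂ (λ a b → R a (- t) ≡ R b (- t)) (left c) (here c)
          (below (-1ℤ - c) (- t)
            (lia 3 (λ c d t → t :≤ c :+ :- d ⇒ goal (:- # 1 :- c :+ d :< :- t)) c (D (-1ℤ - c)) t h)))
    ; below = λ c t h → lia 4 (λ r r′ c t → r :≡ r′ :+ # 1 ⇒ goal (r′ :+ (c :+ # 1 :- t) :≡ r :+ (c :- t)))
        (R (- c) (- t)) (R (- (c + + 1)) (- t)) c t
        (subst₂ (λ a b → R a (- t) ≡ R b (- t) + + 1) (left c) (here c)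
          (above (-1ℤ - c) (- t)
            (lia 3 (λ c d t → c :+ :- d :< t ⇒ goal (:- t :≤ :- # 1 :- c :+ d)) c (D (-1ℤ - c)) t h)))
    ; R≥0 = λ c t → lia 3 (λ r c t → :- c :- :- t :≤ r ⇒ goal (# 0 :≤ r :+ (c :- t)))
        (R (- c) (- t)) c t (R≥c-t (- c) (- t))
    ; R≥c-t = λ c t → lia 3 (λ r c t → # 0 :≤ r ⇒ goal (c :- t :≤ r :+ (c :- t)))
        (R (- c) (- t)) c t (R≥0 (- c) (- t))
    ; R-antitone = λ c t → lia 4
        (λ c t r r′ → r :≤ r′ :+ # 1 ⇒ goal (r :+ (c :- (t :+ # 1)) :≤ r′ :+ (c :- t)))
        c t (R (- c) (- (t + + 1))) (R (- c) (- t))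
        (subst (λ u → R (- c) (- (t + + 1)) ≤ R (- c) u + + 1) (up t) (R-slow (- c) (- (t + + 1))))
    ; R-slow = λ c t → lia 4 (λ c t r r′ → r :≤ r′ ⇒ goal (r :+ (c :- t) :≤ r′ :+ (c :- (t :+ # 1)) :+ # 1))
        c t (R (- c) (- t)) (R (- c) (- (t + + 1)))
        (subst (λ u → R (- c) u ≤ R (- c) (- (t + + 1))) (up t) (R-antitone (- c) (- (t + + 1))))
    ; existsAbove = exAbove
    ; existsBelow = exBelow
    }
    where
    open System S
    left : ∀ c → -1ℤ - c + + 1 ≡ - c
    left = lia 1 (λ c → goal (:- # 1 :- c :+ # 1 :≡ :- c))
    here : ∀ c → -1ℤ - c ≡ - (c + + 1)
    here = lia 1 (λ c → goal (:- # 1 :- c :≡ :- (c :+ # 1)))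
    up : ∀ t → - (t + + 1) + + 1 ≡ - t
    up = lia 1 (λ t → goal (:- (t :+ # 1) :+ # 1 :≡ :- t))
    twice : ∀ z → -1ℤ - (-1ℤ - z) ≡ z
    twice = lia 1 (λ z → goal (:- # 1 :- (:- # 1 :- z) :≡ z))
    exAbove : ∀ c t → + 0 < R (- c) (- t) + (c - t) → ∃ λ y → y < c × t ≤ y + - D (-1ℤ - y)
    exAbove c t h with existsBelow (- c) (- t)
      (lia 3 (λ r c t → # 0 :< r :+ (c :- t) ⇒ goal (:- c :- :- t :< r)) (R (- c) (- t)) c t h)
    ... | z , -c≤z , fz<-t = -1ℤ - z ,
      lia 2 (λ c z → :- c :≤ z ⇒ goal (:- # 1 :- z :< c)) c z -c≤z ,
      subst (λ u → t ≤ -1ℤ - z + - D u) (sym (twice z))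
        (lia 3 (λ z t d → z :+ d :< :- t ⇒ goal (t :≤ :- # 1 :- z :+ :- d)) z t (D z) fz<-t)
    exBelow : ∀ c t → c - t < R (- c) (- t) + (c - t) → ∃ λ y → c ≤ y × y + - D (-1ℤ - y) < t
    exBelow c t h with existsAbove (- c) (- t)
      (lia 3 (λ r c t → c :- t :< r :+ (c :- t) ⇒ goal (# 0 :< r)) (R (- c) (- t)) c t h)
    ... | z , z<-c , -t≤fz = -1ℤ - z ,
      lia 2 (λ c z → z :< :- c ⇒ goal (c :≤ :- # 1 :- z)) c z z<-c ,
      subst (λ u → -1ℤ - z + - D u < t) (sym (twice z))
        (lia 3 (λ z t d → :- t :≤ z :+ d ⇒ goal (:- # 1 :- z :+ :- d :< t)) z t (D z) -t≤fz)

  -- Cuts with p + q at least N - 1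

  module _ (S : System) where
    open System S

    Tight-reflect : ∀ {c p q} → Tight c p q → System.Tight (reflect S) (- c) q p
    Tight-reflect {c} {p} {q} tight = lia 4
      (λ r p q c → r :≡ q ⇒ goal (r :+ (:- c :- (:- c :+ q :- p)) :≡ p))
      (R (- - c) (- (- c + q - p))) p q c
      (trans (cong₂ R (ℤ.neg-involutive c)
        (lia 3 (λ c p q → goal (:- (:- c :+ q :- p) :≡ c :+ p :- q)) c p q)) tight)

    exists-right : ∀ {c p q} → Tight c p q → + 0 < p → ∃ λ y → D y ≤ - q
    exists-right {c} {p} {q} tight 0<p
      with System.exists-left (reflect S) (Tight-reflect {c} {p} {q} tight) 0<p
    ... | y , q≤ = -1ℤ - y , lia 2 (λ q d → q :≤ :- d ⇒ goal (d :≤ :- q)) q (D (-1ℤ - y)) q≤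

    run-right : ∀ {c p q} → Tight c p q → (∀ y → - q ≤ D y) → ∀ x → c ≤ x → x < c + p → D x ≡ - q
    run-right {c} {p} {q} tight ≤D x c≤x x<c+p = trans
      (cong D (lia 1 (λ x → goal (x :≡ :- # 1 :- (:- # 1 :- x))) x))
      (lia 2 (λ d q → :- d :≡ q ⇒ goal (d :≡ :- q)) (D (-1ℤ - (-1ℤ - x))) q
        (System.run-left (reflect S) (Tight-reflect {c} {p} {q} tight)
          (λ y → lia 2 (λ d q → :- q :≤ d ⇒ goal (:- d :≤ q)) (D (-1ℤ - y)) q (≤D (-1ℤ - y)))
          (-1ℤ - x)
          (lia 3 (λ c p x → x :< c :+ p ⇒ goal (:- c :- p :≤ :- # 1 :- x)) c p x x<c+p)
          (lia 2 (λ c x → c :≤ x ⇒ goal (:- # 1 :- x :< :- c)) c x c≤x)))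


    -- When the displacements differ by less than N, they jump from p down
    -- to - q at c, and nowhere else modulo N.
    tight-unique-narrow : ∀ {c c′ p q p′ q′} →
      (∀ x y → D x < D y + N) →
      + 0 < p → + 0 < q → + 0 < p′ → + 0 < q′ → N ≤ p + q + + 1 → N ≤ p′ + q′ + + 1 →
      Tight c p q → Tight c′ p′ q′ → c′ ∼ c
    tight-unique-narrow {c} {c′} {p} {q} {p′} {q′} narrow 0<p 0<q 0<p′ 0<q′ N≤ N≤′ tight tight′
      with exists-left {c} {p} {q} tight 0<q | exists-right {c} {p} {q} tight 0<p
         | exists-left {c′} {p′} {q′} tight′ 0<q′ | exists-right {c′} {p′} {q′} tight′ 0<p′
    ... | a , p≤ | b , ≤q | a′ , p′≤ | b′ , ≤q′ = unique
      where
      upper : ∀ x → D x ≤ p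
      upper x = lia 5 (λ x b p q n → x :< b :+ n ⇒ b :≤ :- q ⇒ n :≤ p :+ q :+ # 1 ⇒ goal (x :≤ p))
        (D x) (D b) p q N (narrow x b) ≤q N≤
      lower : ∀ x → - q ≤ D x
      lower x = lia 5 (λ x a p q n → a :< x :+ n ⇒ p :≤ a ⇒ n :≤ p :+ q :+ # 1 ⇒ goal (:- q :≤ x))
        (D x) (D a) p q N (narrow a x) p≤ N≤
      N≡ : p + q + + 1 ≡ N
      N≡ = lia 5 (λ a b p q n → a :< b :+ n ⇒ p :≤ a ⇒ b :≤ :- q ⇒ n :≤ p :+ q :+ # 1 ⇒
        goal (p :+ q :+ # 1 :≡ n))
        (D a) (D b) p q N (narrow a b) p≤ ≤q N≤
      p′≡p : p′ ≡ p
      p′≡p = lia 9 (λ a b a′ b′ p q p′ q′ n → p :+ q :+ # 1 :≡ n ⇒ n :≤ p′ :+ q′ :+ # 1 ⇒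
          p :≤ a ⇒ b :≤ :- q ⇒ p′ :≤ a′ ⇒ b′ :≤ :- q′ ⇒ a :< b′ :+ n ⇒ a′ :< b :+ n ⇒ goal (p′ :≡ p))
        (D a) (D b) (D a′) (D b′) p q p′ q′ N N≡ N≤′ p≤ ≤q p′≤ ≤q′ (narrow a b′) (narrow a′ b)
      q′≡q : q′ ≡ q
      q′≡q = lia 9 (λ a b a′ b′ p q p′ q′ n → p :+ q :+ # 1 :≡ n ⇒ n :≤ p′ :+ q′ :+ # 1 ⇒
          p :≤ a ⇒ b :≤ :- q ⇒ p′ :≤ a′ ⇒ b′ :≤ :- q′ ⇒ a :< b′ :+ n ⇒ a′ :< b :+ n ⇒ goal (q′ :≡ q))
        (D a) (D b) (D a′) (D b′) p q p′ q′ N N≡ N≤′ p≤ ≤q p′≤ ≤q′ (narrow a b′) (narrow a′ b)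
      unique : c′ ∼ c
      unique with window c c′
      ... | w , c≤w , w<c+N , c′∼w with w ℤ.≟ c
      ... | yes refl = c′∼w
      ... | no w≢c = ⊥-elim contra
        where
        before : D (w - + 1) ≡ p
        before = trans (sym (D-∼ (∼-shift {c′} {w} (- + 1) c′∼w)))
          (trans (run-left {c′} {p′} {q′} tight′ (λ y → subst (D y ≤_) (sym p′≡p) (upper y)) (c′ - + 1)
            (lia 2 (λ c q → # 0 :< q ⇒ goal (c :- q :≤ c :- # 1)) c′ q′ 0<q′)
            (lia 1 (λ c → goal (c :- # 1 :< c)) c′)) p′≡p)
        after : D w ≡ - q
        after = trans (sym (D-∼ c′∼w))
          (trans (run-right {c′} {p′} {q′} tight′ (λ y → subst (λ q → - q ≤ D y) (sym q′≡q) (lower y)) c′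
            ℤ.≤-refl (lia 2 (λ c q → # 0 :< q ⇒ goal (c :< c :+ q)) c′ p′ 0<p′)) (cong -_ q′≡q))
        contra : ⊥
        -- As p + q = N - 1, the period from c on consists of p vertices of displacement - q, the
        -- single vertex c + p, and q vertices of displacement p. Either w - 1 lies in the first
        -- run, or w lies beyond c + p and so in the last one.
        contra with (w - + 1) ℤ.<? (c + p)
        ... | yes w-1< = lia 3 (λ p q d → d :≡ p ⇒ d :≡ :- q ⇒ # 0 :< p ⇒ # 0 :< q ⇒ goal absurd)
          p q (D (w - + 1)) before
          (run-right {c} {p} {q} tight lower (w - + 1)
            (lia 2 (λ c w → c :< w ⇒ goal (c :≤ w :- # 1)) c w (ℤ.≤∧≢⇒< c≤w (≢-sym w≢c))) w-1<)
          0<p 0<q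
        ... | no w-1≮ = lia 4 (λ p q d e → d :≡ p ⇒ e :≡ :- q ⇒ d :≡ e ⇒ # 0 :< p ⇒ # 0 :< q ⇒ goal absurd)
          p q (D (w - N)) (D w)
          (run-left {c} {p} {q} tight upper (w - N)
            (lia 5 (λ c w p q n → c :+ p :≤ w :- # 1 ⇒ p :+ q :+ # 1 :≡ n ⇒
              goal (c :- q :≤ w :- n)) c w p q N (ℤ.≮⇒≥ w-1≮) N≡)
            (lia 3 (λ c w n → w :< c :+ n ⇒ goal (w :- n :< c)) c w N w<c+N))
          after (D-back w) 0<p 0<q

    -- Displacements between M - N and M

    module Wide (M : ℤ) (upper : ∀ x → D x ≤ M) (lower : ∀ x → M - N ≤ D x) where

      Extreme : ℤ → Set
      Extreme x = D x ≡ M ⊎ D x ≡ M - N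

      Extreme-∼ : ∀ {x y} → x ∼ y → Extreme y → Extreme x
      Extreme-∼ x∼y (inj₁ eq) = inj₁ (trans (D-∼ x∼y) eq)
      Extreme-∼ x∼y (inj₂ eq) = inj₂ (trans (D-∼ x∼y) eq)

      tight-p≤ : ∀ {c p q} → Tight c p q → + 0 < q → p ≤ M
      tight-p≤ {c} {p} {q} tight 0<q = let y , p≤ = exists-left {c} {p} {q} tight 0<q in ℤ.≤-trans p≤
        (upper y)

      tight-q≤ : ∀ {c p q} → Tight c p q → + 0 < p → q ≤ N - M
      tight-q≤ {c} {p} {q} tight 0<p = let z , ≤q = exists-right {c} {p} {q} tight 0<p in
        lia 4 (λ d q n m → d :≤ :- q ⇒ m :- n :≤ d ⇒ goal (q :≤ n :- m)) (D z) q N M ≤q (lower z)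

      run-upper : ∀ {c q} → Tight c M q → ∀ x → c - q ≤ x → x < c → D x ≡ M
      run-upper {c} {q} tight = run-left {c} {M} {q} tight upper

      run-lower : ∀ {c p q} → q ≡ N - M → Tight c p q → ∀ x → c ≤ x → x < c + p → D x ≡ M - N
      run-lower {c} {p} {q} refl tight x c≤x x< = trans
        (run-right {c} {p} {q} tight (λ y → subst (_≤ D y) neg (lower y)) x c≤x x<) (sym neg)
        where
        neg : M - N ≡ - (N - M)
        neg = lia 2 (λ n m → goal (m :- n :≡ :- (n :- m))) N M

      tight-full : ∀ {c p q} → + 0 < p → + 0 < q → N ≤ p + q → Tight c p q → p ≡ M × q ≡ N - M
      tight-full {c} {p} {q} 0<p 0<q N≤ tight =
        lia 4 (λ p q m n → n :≤ p :+ q ⇒ p :≤ m ⇒ q :≤ n :- m ⇒ goal (p :≡ m)) p q M N N≤ p≤ q≤ ,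
        lia 4 (λ p q m n → n :≤ p :+ q ⇒ p :≤ m ⇒ q :≤ n :- m ⇒ goal (q :≡ n :- m)) p q M N N≤ p≤ q≤
        where
        p≤ = tight-p≤ {c} {p} {q} tight 0<q
        q≤ = tight-q≤ {c} {p} {q} tight 0<p

      -- Here p = M and q = N - M, so the runs on the two sides of c together fill a period.
      tight-full⇒Extreme : ∀ {c p q} → + 0 < p → + 0 < q → N ≤ p + q → Tight c p q → ∀ x → Extreme x
      tight-full⇒Extreme {c} {p} {q} 0<p 0<q N≤ tight x with tight-full {c} {p} {q} 0<p 0<q N≤ tight
      ... | refl , refl with window (c - q) x
      ... | y , ≤y , y< , x∼y with y ℤ.<? c
      ... | yes y<c = Extreme-∼ x∼y (inj₁ (run-upper {c} {q} tight y ≤y y<c))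
      ... | no y≮c = Extreme-∼ x∼y (inj₂ (run-lower {c} {p} {q} refl tight y (ℤ.≮⇒≥ y≮c)
        (lia 4 (λ c y m n → y :< c :- (n :- m) :+ n ⇒ goal (y :< c :+ m)) c y M N y<)))

      module _ {c q} (0<q : + 0 < q) (sum : M + q + + 1 ≡ N) (tight : Tight c M q) where

        private t = c + M - q

        -- R rises only from q to q + 1 between c and c + M + 1, and it does so at w.
        below-except : ∀ {w} → c ≤ w → w ≤ c + M → D w ≡ M → ∀ x → c ≤ x → x ≤ c + M → x ≢ w → f x < t
        below-except {w} c≤w w≤ Dw x c≤x x≤ x≢w with f x ℤ.<? t
        ... | yes fx<t = fx<t
        ... | no fx≮t = ⊥-elim
          (lia 5 (λ r r′ c m q → r :≡ q ⇒ r :+ # 2 :≤ r′ ⇒ r′ :≤ c :+ m :+ # 1 :- (c :+ m :- q) ⇒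
          goal absurd)
          (R c t) (R (c + M + + 1) t) c M q tight two last)
          where
          fw≥ : t ≤ f w
          fw≥ = lia 5 (λ c w d m q → c :≤ w ⇒ d :≡ m ⇒ # 0 :< q ⇒ goal (c :+ m :- q :≤ w :+ d)) c w
            (D w) M q c≤w Dw 0<q
          fx≥ : t ≤ f x
          fx≥ = ℤ.≮⇒≥ fx≮t
          end : ∀ {y} → y ≤ c + M → y < c + M + + 1
          end {y} = lia 2 (λ y u → y :≤ u ⇒ goal (y :< u :+ # 1)) y (c + M)
          two : R c t + + 2 ≤ R (c + M + + 1) t
          two with x ℤ.<? w
          ... | yes x<w = R-two-above t c≤x x<w (end w≤) fx≥ fw≥
          ... | no x≮w = R-two-above t c≤w (ℤ.≤∧≢⇒< (ℤ.≮⇒≥ x≮w) (≢-sym x≢w)) (end x≤) fw≥ fx≥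
          -- The right-hand side is q + 1. A pebble from c + M + 1 on cannot get below t, because c
          -- + M + 1 + (M - N) = t.
          last : R (c + M + + 1) t ≤ c + M + + 1 - t
          last with (c + M + + 1 - t) ℤ.<? R (c + M + + 1) t
          ... | no ≮ = ℤ.≮⇒≥ ≮
          ... | yes < with existsBelow (c + M + + 1) t <
          ... | z , ≤z , fz<t = ⊥-elim (lia 6 (λ c m q n z d →
              c :+ m :+ # 1 :≤ z ⇒ z :+ d :< c :+ m :- q ⇒ m :- n :≤ d ⇒ m :+ q :+ # 1 :≡ n ⇒ goal absurd)
            c M q N z (D z) ≤z fz<t (lower z) sum)

        -- Descending from c + M to c, each x other than w is sent to a value in
        -- [x + M - N , t), all of which except the smallest are already taken.
        rigid : ∀ {w} → c ≤ w → w ≤ c + M → D w ≡ M → ∀ x → Extreme x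
        rigid {w} c≤w w≤ Dw x with window (c - q) x
        ... | y , ≤y , y< , x∼y with y ℤ.<? c
        ... | yes y<c = Extreme-∼ x∼y (inj₁ (run-upper {c} {q} tight y ≤y y<c))
        ... | no y≮c = Extreme-∼ x∼y (all y (ℤ.≮⇒≥ y≮c) y≤)
          where
          y≤ : y ≤ c + M
          y≤ = lia 5 (λ c y m q n → y :< c :- q :+ n ⇒ m :+ q :+ # 1 :≡ n ⇒
            goal (y :≤ c :+ m)) c y M q N y< sum
          forced : ∀ x → c ≤ x → x ≤ c + M → (∀ y → x < y → y ≤ c + M → Extreme y) → Extreme x
          forced x c≤x x≤ taken with x ℤ.≟ w
          ... | yes refl = inj₁ Dw
          -- From the vertex x + D x - M + N the displacement M - N leads to f x; N vertices
          -- earlier, the displacement M does. If that vertex is extreme and differs from x,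
          -- injectivity is violated in the first case, and in the second it would lie a full period
          -- to the right of x, outside the window.
          ... | no x≢w with (x + D x - M + N) ℤ.≟ x
          ... | yes eq = inj₂
            (lia 4 (λ x d m n → x :+ d :- m :+ n :≡ x ⇒ goal (d :≡ m :- n)) x (D x) M N eq)
          ... | no y≢x = ⊥-elim (clash (taken (x + D x - M + N) x<y y≤′))
            where
            x<y : x < x + D x - M + N
            x<y = ℤ.≤∧≢⇒< (lia 4 (λ x d m n → m :- n :≤ d ⇒ goal (x :≤ x :+ d :- m :+ n)) x (D x) M N
              (lower x)) (≢-sym y≢x)
            y≤′ : x + D x - M + N ≤ c + M
            y≤′ = lia 6 (λ c x d m n q → x :+ d :< c :+ m :- q ⇒ m :+ q :+ # 1 :≡ n ⇒
              goal (x :+ d :- m :+ n :≤ c :+ m))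
              c x (D x) M N q (below-except c≤w w≤ Dw x c≤x x≤ x≢w) sum
            clash : ¬ Extreme (x + D x - M + N)
            clash (inj₂ eq) = y≢x
              (injective _ x (lia 5 (λ x d e m n → e :≡ m :- n ⇒ goal (x :+ d :- m :+ n :+ e :≡ x :+ d))
              x (D x) (D (x + D x - M + N)) M N eq))
            clash (inj₁ eq) = lia 6 (λ c x d m n q →
                x :+ d :- m :+ n :- n :≡ x ⇒ c :≤ x ⇒ x :+ d :- m :+ n :≤ c :+ m ⇒ m :+ q :+ # 1 :≡ n ⇒
                  # 0 :< q ⇒ goal absurd)
              c x (D x) M N q
              (injective _ x (lia 5 (λ x d e m n → e :≡ m ⇒ goal (x :+ d :- m :+ n :- n :+ e :≡ x :+ d))
                x (D x) (D (x + D x - M + N - N)) M N (trans (D-back _) eq)))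
              c≤x y≤′ sum 0<q
          all : ∀ x → c ≤ x → x ≤ c + M → Extreme x
          all x c≤x x≤ = descend {λ u → c ≤ u → ∀ x → u ≤ x → x ≤ c + M → Extreme x} (c + M + + 1)
            (λ _ x u≤x x≤ → ⊥-elim (lia 2 (λ x u → u :+ # 1 :≤ x ⇒ x :≤ u ⇒ goal absurd) x (c + M) u≤x x≤))
            (λ u u< IH c≤u x u≤x x≤ → step u u< (IH (ℤ.≤-trans c≤u (ℤ.i≤i+j u (+ 1)))) c≤u x u≤x x≤)
            x (ℤ.≤-trans x≤ (ℤ.i≤i+j (c + M) (+ 1))) c≤x x ℤ.≤-refl x≤
            where
            step : ∀ u → u < c + M + + 1 → (∀ x → u + + 1 ≤ x → x ≤ c + M → Extreme x) →
                   c ≤ u → ∀ x → u ≤ x → x ≤ c + M → Extreme x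
            step u u< IH c≤u x u≤x x≤ with u ℤ.≟ x
            ... | yes refl = forced u c≤u x≤
              (λ y u<y → IH y (lia 2 (λ u y → u :< y ⇒ goal (u :+ # 1 :≤ y)) u y u<y))
            ... | no u≢x = IH x (lia 2 (λ u y → u :< y ⇒ goal (u :+ # 1 :≤ y)) u x (ℤ.≤∧≢⇒< u≤x u≢x)) x≤

        -- A second drop has a vertex of displacement M at w - 1. Between c and c + M this would
        -- trigger `rigid`; further right, w itself belongs to the run of displacement M that ends
        -- before c + N.
        drop-unique : ¬ (∀ x → Extreme x) → ∀ w → D (w - + 1) ≡ M → D w ≢ M → w ∼ c
        drop-unique ¬extreme w Dw-1 Dw with window c w
        ... | v , c≤v , v< , w∼v with v ℤ.≟ c
        ... | yes refl = w∼v
        ... | no v≢c with (v - + 1) ℤ.≤? (c + M)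
        ... | yes v-1≤ = ⊥-elim (¬extreme (rigid {v - + 1}
          (lia 2 (λ c w → c :< w ⇒ goal (c :≤ w :- # 1)) c v (ℤ.≤∧≢⇒< c≤v (≢-sym v≢c))) v-1≤
          (trans (sym (D-∼ (∼-shift {w} {v} (- + 1) w∼v))) Dw-1)))
        ... | no v-1≰ = ⊥-elim (Dw (trans (D-∼ w∼v) (trans (sym (D-back v)) (run-upper {c} {q} tight (v - N)
          (lia 5 (λ c m q v n → c :+ m :< v :- # 1 ⇒ m :+ q :+ # 1 :≡ n ⇒ goal (c :- q :≤ v :- n)) c M q v N
            (ℤ.≰⇒> v-1≰) sum)
          (lia 3 (λ c v n → v :< c :+ n ⇒ goal (v :- n :< c)) c v N v<)))))

  -- Mirror images and pairs of tight cuts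

  module _ (S : System) (M : ℤ) (upper : ∀ x → System.D S x ≤ M) (lower : ∀ x → M - N ≤ System.D S x) where
    open System S
    open Wide S M upper lower

    private
      reflect-D : ∀ x → System.D (reflect S) (-1ℤ - x) ≡ - D x
      reflect-D x = cong (λ y → - D y) (lia 1 (λ x → goal (:- # 1 :- (:- # 1 :- x) :≡ x)) x)

      upperʳ : ∀ x → System.D (reflect S) x ≤ N - M
      upperʳ x = lia 3 (λ m n d → m :- n :≤ d ⇒ goal (:- d :≤ n :- m)) M N (D (-1ℤ - x)) (lower (-1ℤ - x))

      lowerʳ : ∀ x → N - M - N ≤ System.D (reflect S) x
      lowerʳ x = lia 3 (λ m n d → d :≤ m ⇒ goal (n :- m :- n :≤ :- d)) M N (D (-1ℤ - x)) (upper (-1ℤ - x))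

      module Wideʳ = Wide (reflect S) (N - M) upperʳ lowerʳ

      Extreme-reflect : (∀ x → Wideʳ.Extreme x) → ∀ x → Extreme x
      Extreme-reflect extreme x with extreme (-1ℤ - x)
      ... | inj₁ eq = inj₂ (lia 4 (λ d d′ m n → d′ :≡ :- d ⇒ d′ :≡ n :- m ⇒ goal (d :≡ m :- n))
        (D x) _ M N (reflect-D x) eq)
      ... | inj₂ eq = inj₁ (lia 4 (λ d d′ m n → d′ :≡ :- d ⇒ d′ :≡ n :- m :- n ⇒ goal (d :≡ m))
        (D x) _ M N (reflect-D x) eq)

      reflect-D-1 : ∀ w → System.D (reflect S) (- w) ≡ - D (w - + 1)
      reflect-D-1 w = trans
        (cong (System.D (reflect S)) (lia 1 (λ w → goal (:- w :≡ :- # 1 :- (w :- # 1))) w))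
        (reflect-D (w - + 1))

    -- This is `rigid` in the mirror image, where N - M takes the place of M and p that of q. The
    -- exceptional vertex is - c, the reflection of c - 1.
    rigidʳ : ∀ {c p} → + 0 < p → p + + 1 ≡ M → M < N → Tight c p (N - M) →
      D (c - + 1) ≡ M - N → ∀ x → Extreme x
    rigidʳ {c} {p} 0<p p+1≡M M<N tight Dc-1 = Extreme-reflect (Wideʳ.rigid {q = p} 0<p
      (lia 3 (λ m n p → p :+ # 1 :≡ m ⇒ goal (n :- m :+ p :+ # 1 :≡ n)) M N p p+1≡M)
      (Tight-reflect S {c} {p} {N - M} tight) ℤ.≤-refl
      (lia 3 (λ c m n → m :< n ⇒ goal (:- c :≤ :- c :+ (n :- m))) c M N M<N)
      (trans (reflect-D-1 c)
        (lia 3 (λ d m n → d :≡ m :- n ⇒ goal (:- d :≡ n :- m)) (D (c - + 1)) M N Dc-1)))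

    drop-uniqueʳ : ∀ {c p} → + 0 < p → p + + 1 ≡ M → Tight c p (N - M) →
      ¬ (∀ x → Extreme x) → ∀ w → D w ≡ M - N → D (w - + 1) ≢ M - N → w ∼ c
    drop-uniqueʳ {c} {p} 0<p p+1≡M tight ¬extreme w Dw Dw-1 =
      back (Wideʳ.drop-unique {q = p} 0<p
        (lia 3 (λ m n p → p :+ # 1 :≡ m ⇒ goal (n :- m :+ p :+ # 1 :≡ n)) M N p p+1≡M)
        (Tight-reflect S {c} {p} {N - M} tight)
        (λ extreme → ¬extreme (Extreme-reflect extreme)) (- w) at-w
        (λ eq → Dw-1 (lia 4 (λ d d′ m n → d′ :≡ n :- m ⇒ d′ :≡ :- d ⇒ goal (d :≡ m :- n))
          (D (w - + 1)) _ M N eq at-w-1)))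
      where
      back : - w ∼ - c → w ∼ c
      back (multiple k eq) = multiple (- k)
        (trans (sym (ℤ.neg-involutive w)) (trans (cong -_ eq) (lem c k N)))
        where
        lem : ∀ c k N → - (- c + k * N) ≡ c + - k * N
        lem = solve-∀
      at-w : System.D (reflect S) (- w - + 1) ≡ N - M
      at-w = lia 4 (λ d d′ m n → d′ :≡ :- d ⇒ d :≡ m :- n ⇒ goal (d′ :≡ n :- m)) (D w) _ M N
        (trans (cong (System.D (reflect S)) (lia 1 (λ w → goal (:- w :- # 1 :≡ :- # 1 :- w)) w))
          (reflect-D w)) Dw
      at-w-1 = reflect-D-1 w

    -- The only way in which two cuts of different parity can be tight: the
    -- displacements are M … M, x, M - N … M - N, y for some x and y.
    record Interlocked : Set where
      field
        no-drop : ∀ x → D x ≡ M → D (x + + 1) ≢ M - N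
        gap : ℤ
        before : D (gap - + 1) ≡ M
        after : D (gap + + 1) ≡ M - N
        long : D (gap - + 1 - + 1) ≡ M ⊎ D (gap + + 1 + + 1) ≡ M - N

    interlocked : ∀ {c q c′ p′} → + 6 ≤ N → ¬ (∀ x → Extreme x) →
      + 0 < q → M + q + + 1 ≡ N → Tight c M q →
      + 0 < p′ → p′ + + 1 ≡ M → Tight c′ p′ (N - M) →
      ¬ c′ ∼ c → ¬ c′ ∼ c + + 2 → Interlocked
    interlocked {c} {q} {c′} {p′} 6≤N ¬extreme 0<q sum tight 0<p′ p′+1≡M tight′ c′≁c c′≁c+2 = record
      -- A direct drop from M to M - N would have to sit at c, where the run of M ends, and at c′,
      -- where the run of M - N begins.
      { no-drop = λ x Dx Dx+1 → c′≁c (∼-trans {z = c}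
          (∼-sym (drop-uniqueʳ {c′} {p′} 0<p′ p′+1≡M tight′ ¬extreme (x + + 1) Dx+1
            (λ eq → M≢M-N (trans (sym Dx) (trans (cong D (back x)) eq)))))
          (drop-unique 0<q sum tight ¬extreme (x + + 1) (trans (cong D (sym (back x))) Dx)
            (λ eq → M≢M-N (trans (sym eq) Dx+1))))
      ; gap = c
      ; before = Dc-1
      ; after = trans (sym (D-∼ c′∼c+1))
        (run-lower {c′} {p′} refl tight′ c′ ℤ.≤-refl (0<p⇒c<c+p c′ p′ 0<p′))
      ; long = long
      }
      where
      back : ∀ x → x ≡ x + + 1 - + 1
      back = lia 1 (λ x → goal (x :≡ x :+ # 1 :- # 1))
      M≢M-N : M ≢ M - N
      M≢M-N = lia 2 (λ m n → # 6 :≤ n ⇒ m :≡ m :- n ⇒ goal absurd) M N 6≤N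
      0<p⇒c<c+p : ∀ c p → + 0 < p → c < c + p
      0<p⇒c<c+p = lia 2 (λ c p → # 0 :< p ⇒ goal (c :< c :+ p))
      Dc-1 : D (c - + 1) ≡ M
      Dc-1 = run-upper {c} {q} tight (c - + 1)
        (lia 2 (λ c q → # 0 :< q ⇒ goal (c :- q :≤ c :- # 1)) c q 0<q)
        (lia 1 (λ c → goal (c :- # 1 :< c)) c)
      c′∼c+1 : c′ ∼ c + + 1
      c′∼c+1 with window c c′
      ... | w , c≤w , w< , c′∼w with w ℤ.≟ c | w ℤ.≟ c + + 1 | w ℤ.≟ c + + 2
      ... | yes refl | _ | _ = ⊥-elim (c′≁c c′∼w)
      ... | _ | yes refl | _ = c′∼w
      ... | _ | _ | yes refl = ⊥-elim (c′≁c+2 c′∼w)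
      -- The run of M - N has length p′ = M - 1. Starting at c + 3 or later it reaches c + M + 1 = c
      -- + N - q, where the next run of M begins. Starting at c + 2 it would just miss that run, so
      -- that position is excluded by hypothesis.
      ... | no ≢c | no ≢c+1 | no ≢c+2 = ⊥-elim clash
        where
        c+3≤w : c + + 3 ≤ w
        c+3≤w = lia 2 (λ c w → c :+ # 2 :< w ⇒ goal (c :+ # 3 :≤ w)) c w
          (ℤ.≤∧≢⇒< (lia 2 (λ c w → c :+ # 1 :< w ⇒ goal (c :+ # 2 :≤ w)) c w
            (ℤ.≤∧≢⇒< (lia 2 (λ c w → c :< w ⇒ goal (c :+ # 1 :≤ w)) c w
              (ℤ.≤∧≢⇒< c≤w (≢-sym ≢c))) (≢-sym ≢c+1))) (≢-sym ≢c+2))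
        low : ∀ x → w ≤ x → x < w + p′ → D x ≡ M - N
        low x w≤x x< = trans
          (sym (D-∼ (subst (c′ + (x - w) ∼_) (lia 2 (λ w x → goal (w :+ (x :- w) :≡ x)) w x)
          (∼-shift {c′} {w} (x - w) c′∼w))))
          (run-lower {c′} {p′} refl tight′ (c′ + (x - w))
            (lia 3 (λ c w x → w :≤ x ⇒ goal (c :≤ c :+ (x :- w))) c′ w x w≤x)
            (lia 4 (λ c w x p → x :< w :+ p ⇒ goal (c :+ (x :- w) :< c :+ p)) c′ w x p′ x<))
        clash : ⊥
        clash with (c + N - + 1) ℤ.<? (w + p′)
        ... | yes < = M≢M-N (trans (sym Dc-1) (trans (sym (periodic (c - + 1)))
          (trans (cong D (lia 2 (λ c n → goal (c :- # 1 :+ n :≡ c :+ n :- # 1)) c N))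
            (low (c + N - + 1) (lia 3 (λ c w n → w :< c :+ n ⇒ goal (w :≤ c :+ n :- # 1)) c w N w<) <))))
        ... | no ≮ = M≢M-N (trans (sym (run-upper {c} {q} tight (w + p′ - + 1 - N)
            (lia 6 (λ c w p m n q → c :+ # 3 :≤ w ⇒ p :+ # 1 :≡ m ⇒ m :+ q :+ # 1 :≡ n ⇒
              goal (c :- q :≤ w :+ p :- # 1 :- n))
              c w p′ M N q c+3≤w p′+1≡M sum)
            (lia 4 (λ c w p n → w :+ p :≤ c :+ n :- # 1 ⇒ goal (w :+ p :- # 1 :- n :< c)) c w p′ N
              (ℤ.≮⇒≥ ≮))))
          (trans (D-back _) (low (w + p′ - + 1)
            (lia 2 (λ w p → # 0 :< p ⇒ goal (w :≤ w :+ p :- # 1)) w p′ 0<p′)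
            (lia 2 (λ w p → goal (w :+ p :- # 1 :< w :+ p)) w p′))))
      long : D (c - + 1 - + 1) ≡ M ⊎ D (c + + 1 + + 1) ≡ M - N
      -- If q = 1, then M = N - 2 and the other run has length p′ = N - 3, which is at least 2.
      long with + 1 ℤ.<? q
      ... | yes 1<q = inj₁ (run-upper {c} {q} tight (c - + 1 - + 1)
        (lia 2 (λ c q → # 1 :< q ⇒ goal (c :- q :≤ c :- # 1 :- # 1)) c q 1<q)
        (lia 1 (λ c → goal (c :- # 1 :- # 1 :< c)) c))
      ... | no 1≮q = inj₂ (trans (sym (D-∼ (∼-shift {c′} {c + + 1} (+ 1) c′∼c+1)))
        (run-lower {c′} {p′} refl tight′ (c′ + + 1) (ℤ.i≤i+j c′ (+ 1))
          (lia 5 (λ c p m n q → q :≤ # 1 ⇒ m :+ q :+ # 1 :≡ n ⇒ p :+ # 1 :≡ m ⇒ # 6 :≤ n ⇒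
            goal (c :+ # 1 :< c :+ p))
            c′ p′ M N q (ℤ.≮⇒≥ 1≮q) sum p′+1≡M 6≤N)))

    -- Since p + q ≥ N would make every vertex extreme, one of p ≤ M and q ≤ N - M is an equality
    -- and the other fails by one. Two cuts of the same kind both sit at the unique end of the run
    -- of M, or both at the unique start of the run of M - N, and so agree modulo N. One cut of each
    -- kind remains.
    tight-two⇒interlocked : ∀ {c p q c′ p′ q′} → + 6 ≤ N → ¬ (∀ x → Extreme x) →
      + 0 < p → + 0 < q → N ≤ p + q + + 1 → Tight c p q →
      + 0 < p′ → + 0 < q′ → N ≤ p′ + q′ + + 1 → Tight c′ p′ q′ →
      ¬ c′ ∼ c → ¬ c′ ∼ c + + 2 → ¬ c ∼ c′ + + 2 → Interlocked
    tight-two⇒interlocked {c} {p} {q} {c′} {p′} {q′} 6≤N ¬extreme 0<p 0<q N≤ tight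
      0<p′ 0<q′ N≤′ tight′ c′≁c c′≁c+2 c≁c′+2 = result
      where
      classify : ∀ {c p q} → + 0 < p → + 0 < q → N ≤ p + q + + 1 → Tight c p q →
        (p ≡ M × M + q + + 1 ≡ N) ⊎ (p + + 1 ≡ M × q ≡ N - M)
      classify {c} {p} {q} 0<p 0<q N≤ tight with N ℤ.≤? p + q
      ... | yes N≤p+q = ⊥-elim (¬extreme (tight-full⇒Extreme {c} {p} {q} 0<p 0<q N≤p+q tight))
      ... | no N≰p+q with p ℤ.≟ M
      ... | yes refl = inj₁
        (refl , lia 3 (λ p q n → n :≤ p :+ q :+ # 1 ⇒ p :+ q :< n ⇒ goal (p :+ q :+ # 1 :≡ n)) p q N N≤
        (ℤ.≰⇒> N≰p+q))
      ... | no p≢M = inj₂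
        ( lia 4 (λ p q m n → n :≤ p :+ q :+ # 1 ⇒ p :+ q :< n ⇒ p :< m ⇒ q :≤ n :- m ⇒
          goal (p :+ # 1 :≡ m)) p q M N N≤ (ℤ.≰⇒> N≰p+q) p<M q≤
        , lia 4 (λ p q m n → n :≤ p :+ q :+ # 1 ⇒ p :+ q :< n ⇒ p :< m ⇒ q :≤ n :- m ⇒
          goal (q :≡ n :- m)) p q M N N≤ (ℤ.≰⇒> N≰p+q) p<M q≤)
        where
        p<M = ℤ.≤∧≢⇒< (tight-p≤ {c} {p} {q} tight 0<q) p≢M
        q≤ = tight-q≤ {c} {p} {q} tight 0<p
      M≢M-N : M ≢ M - N
      M≢M-N = lia 2 (λ m n → # 6 :≤ n ⇒ m :≡ m :- n ⇒ goal absurd) M N 6≤N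
      result : Interlocked
      result with classify {c} {p} {q} 0<p 0<q N≤ tight | classify {c′} {p′} {q′} 0<p′ 0<q′ N≤′ tight′
      ... | inj₁ (refl , sum) | inj₂ (p′+1≡M , refl) =
        interlocked {c} {q} {c′} {p′} 6≤N ¬extreme 0<q sum tight 0<p′ p′+1≡M tight′ c′≁c c′≁c+2
      ... | inj₂ (p+1≡M , refl) | inj₁ (refl , sum) =
        interlocked {c′} {q′} {c} {p} 6≤N ¬extreme 0<q′ sum tight′ 0<p p+1≡M tight
          (λ c∼c′ → c′≁c (∼-sym c∼c′)) c≁c′+2
      ... | inj₁ (refl , sum) | inj₁ (refl , sum′) = ⊥-elim (c′≁c
        (drop-unique 0<q sum tight ¬extreme c′
          (run-upper {c′} {q′} tight′ (c′ - + 1)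
            (lia 2 (λ c q → # 0 :< q ⇒ goal (c :- q :≤ c :- # 1)) c′ q′ 0<q′)
            (lia 1 (λ c → goal (c :- # 1 :< c)) c′))
          (λ eq → ¬extreme (rigid 0<q′ sum′ tight′ ℤ.≤-refl
            (lia 2 (λ c m → # 0 :< m ⇒ goal (c :≤ c :+ m)) c′ M 0<p′) eq))))
      ... | inj₂ (p+1≡M , refl) | inj₂ (p′+1≡M , refl) with D (c′ - + 1) ℤ.≟ M - N
      ... | no ≢ = ⊥-elim (c′≁c (drop-uniqueʳ {c} {p} 0<p p+1≡M tight ¬extreme c′
          (run-lower {c′} {p′} refl tight′ c′ ℤ.≤-refl
            (lia 2 (λ c p → # 0 :< p ⇒ goal (c :< c :+ p)) c′ p′ 0<p′)) ≢))
      ... | yes eq = ⊥-elim (¬extreme (rigidʳ {c′} {p′} 0<p′ p′+1≡M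
          (lia 2 (λ m n → # 0 :< n :- m ⇒ goal (m :< n)) M N 0<q′) tight′ eq))

    -- Two vertices on each side, so that either side contains both parities; a choice of pebbles by
    -- parity can then be contradicted wherever the cut lies. Both runs being this long is what 1 <
    -- M and M + 1 < N provide.
    Full : ℤ → Set
    Full c = D (c - + 1 - + 1) ≡ M × D (c - + 1) ≡ M × D c ≡ M - N × D (c + + 1) ≡ M - N

    tight⇒Full : ∀ {c p q} → + 1 < M → M + + 1 < N → + 0 < p → + 0 < q → N ≤ p + q → Tight c p q → Full c
    tight⇒Full {c} {p} {q} 1<M M<N-1 0<p 0<q N≤ tight with tight-full {c} {p} {q} 0<p 0<q N≤ tight
    ... | refl , refl =
      run-upper {c} {N - M} tight (c - + 1 - + 1)
        (lia 3 (λ c m n → m :+ # 1 :< n ⇒ goal (c :- (n :- m) :≤ c :- # 1 :- # 1)) c M N M<N-1)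
        (lia 1 (λ c → goal (c :- # 1 :- # 1 :< c)) c) ,
      run-upper {c} {N - M} tight (c - + 1)
        (lia 3 (λ c m n → m :+ # 1 :< n ⇒ goal (c :- (n :- m) :≤ c :- # 1)) c M N M<N-1)
        (lia 1 (λ c → goal (c :- # 1 :< c)) c) ,
      run-lower {c} {M} refl tight c ℤ.≤-refl (lia 2 (λ c m → # 1 :< m ⇒ goal (c :< c :+ m)) c M 1<M) ,
      run-lower {c} {M} refl tight (c + + 1) (ℤ.i≤i+j c (+ 1))
        (lia 2 (λ c m → # 1 :< m ⇒ goal (c :+ # 1 :< c :+ m)) c M 1<M)

    -- A value N - 1 of H c t is a local maximum in c, unless H is N next to it.
    tight⇒drop : ∀ {c p q} → (∀ x → Extreme x) → + 1 < M → M + + 1 < N →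
      + 0 < p → + 0 < q → N ≤ p + q + + 1 → Tight c p q →
      (D (c - + 1) ≡ M × D c ≡ M - N) ⊎ Full (c - + 1) ⊎ Full (c + + 1)
    tight⇒drop {c} {p} {q} extreme 1<M M<N-1 0<p 0<q N≤ tight with (c + p - q) ℤ.≤? f c
    ... | yes t≤ = inj₂ (inj₂ (tight⇒Full {c + + 1} {p} {q + + 1} 1<M M<N-1 0<p
      (lia 1 (λ q → # 0 :< q ⇒ goal (# 0 :< q :+ # 1)) q 0<q)
      (lia 3 (λ p q n → n :≤ p :+ q :+ # 1 ⇒ goal (n :≤ p :+ (q :+ # 1))) p q N N≤)
      (trans (cong (R (c + + 1))
        (lia 3 (λ c p q → goal (c :+ # 1 :+ p :- (q :+ # 1) :≡ c :+ p :- q)) c p q))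
        (trans (above c _ t≤) (cong (_+ + 1) tight)))))
    ... | no t≰ with f (c - + 1) ℤ.<? (c + p - q)
    ... | yes < = inj₂ (inj₁ (tight⇒Full {c - + 1} {p + + 1} {q} 1<M M<N-1
      (lia 1 (λ q → # 0 :< q ⇒ goal (# 0 :< q :+ # 1)) p 0<p) 0<q
      (lia 3 (λ p q n → n :≤ p :+ q :+ # 1 ⇒ goal (n :≤ p :+ # 1 :+ q)) p q N N≤)
      (trans (cong (R (c - + 1))
        (lia 3 (λ c p q → goal (c :- # 1 :+ (p :+ # 1) :- q :≡ c :+ p :- q)) c p q))
        (trans (sym (below (c - + 1) _ <))
          (trans (cong (λ c′ → R c′ (c + p - q)) (lia 1 (λ c → goal (c :- # 1 :+ # 1 :≡ c)) c)) tight)))))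
    ... | no ≮ = inj₁ (high , low)
      where
      p≤ = tight-p≤ {c} {p} {q} tight 0<q
      q≤ = tight-q≤ {c} {p} {q} tight 0<p
      high : D (c - + 1) ≡ M
      high with extreme (c - + 1)
      ... | inj₁ eq = eq
      ... | inj₂ eq = ⊥-elim (lia 6 (λ c p q m n d → c :+ p :- q :≤ c :- # 1 :+ d ⇒ d :≡ m :- n ⇒
          q :≤ n :- m ⇒ n :≤ p :+ q :+ # 1 ⇒ # 1 :< m ⇒ goal absurd)
        c p q M N (D (c - + 1)) (ℤ.≮⇒≥ ≮) eq q≤ N≤ 1<M)
      low : D c ≡ M - N
      low with extreme c
      ... | inj₂ eq = eq
      ... | inj₁ eq = ⊥-elim (lia 6 (λ c p q m n d → c :+ d :< c :+ p :- q ⇒ d :≡ m ⇒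
          p :≤ m ⇒ n :≤ p :+ q :+ # 1 ⇒ m :+ # 1 :< n ⇒ goal absurd)
        c p q M N (D c) (ℤ.≰⇒> t≰) eq p≤ N≤ M<N-1)

-- Odd-even transposition sort

oddℕ : ℕ → Bool
oddℕ zero = false
oddℕ (suc k) = not (oddℕ k)

odd : ℤ → Bool
odd z = oddℕ ∣ z ∣

odd-suc : ∀ z → odd (z + + 1) ≡ not (odd z)
odd-suc (+ k) rewrite ℕ.+-comm k 1 = refl
odd-suc -[1+ zero ] = refl
odd-suc -[1+ suc k ] = sym (not-involutive (not (oddℕ k)))

-- The cuts between z - 1 and z that are compared in a step are those whose
-- position z is odd (α = true), or even (α = false).
active : Bool → ℤ → Bool
active true z = odd z
active false z = not (odd z)

active-suc : ∀ α z → active α (z + + 1) ≡ not (active α z)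
active-suc true z = odd-suc z
active-suc false z = cong not (odd-suc z)

active-pred : ∀ α z → active α (z - + 1) ≡ not (active α z)
active-pred α z = trans (sym (not-involutive _)) (cong not (trans (sym (active-suc α (z - + 1)))
  (cong (active α) (lia 1 (λ z → goal (z :- # 1 :+ # 1 :≡ z)) z))))

active-not : ∀ α z → active (not α) z ≡ not (active α z)
active-not true z = refl
active-not false z = sym (not-involutive (odd z))

State : Set
State = ℤ → ℤ

-- A state gives for each vertex the destination of the pebble there. Active cuts alternate, so if
-- the cut before z is not compared, the one after z is.
step : Bool → State → State
step α f z = if active α z then f (z - + 1) ⊔ f z else f z ⊓ f (z + + 1)

run : ℕ → Bool → State → State
run zero α f = f
run (suc k) α f = run k (not α) (step α f)

record Height (f : State) (R : ℤ → ℤ → ℤ) : Set where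
  field
    above : ∀ c t → t ≤ f c → R (c + + 1) t ≡ R c t + + 1
    below : ∀ c t → f c < t → R (c + + 1) t ≡ R c t
    R≥0 : ∀ c t → + 0 ≤ R c t
    R≥c-t : ∀ c t → c - t ≤ R c t

-- A comparison only lowers the local maxima of H c t = 2 R c t - (c - t) in c:
-- at an active c, the new value is max (H (c - 1) t) (H (c + 1) t) - 1.
stepR : Bool → (ℤ → ℤ → ℤ) → ℤ → ℤ → ℤ
stepR α R c t = if active α c then R (c - + 1) t ⊔ (R (c + + 1) t - + 1) else R c t

⊔-lub-< : ∀ {x y t} → x < t → y < t → x ⊔ y < t
⊔-lub-< {x} {y} {t} x< y< with ℤ.⊔-sel x y
... | inj₁ eq = subst (_< t) (sym eq) x<
... | inj₂ eq = subst (_< t) (sym eq) y<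

module _ {t x y r₀ r₁ r₂ : ℤ}
  (x↑ : t ≤ x → r₁ ≡ r₀ + + 1) (x↓ : x < t → r₁ ≡ r₀)
  (y↑ : t ≤ y → r₂ ≡ r₁ + + 1) (y↓ : y < t → r₂ ≡ r₁) where

  -- The zero-one principle: only whether x and y reach t matters. The cases are two, one or none
  -- reaching it; with exactly one, both orders lead to the same new middle value, the one with the
  -- large entry on the right.
  compare-heights : (t ≤ x × t ≤ y × r₀ ⊔ (r₂ - + 1) ≡ r₀ + + 1 × r₂ ≡ r₀ + + 2) ⊎
    (((t ≤ x × y < t) ⊎ (x < t × t ≤ y)) × r₀ ⊔ (r₂ - + 1) ≡ r₀ × r₂ ≡ r₀ + + 1) ⊎
    (x < t × y < t × r₀ ⊔ (r₂ - + 1) ≡ r₀ × r₂ ≡ r₀)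
  compare-heights with t ℤ.≤? x | t ℤ.≤? y
  ... | yes t≤x | yes t≤y rewrite y↑ t≤y | x↑ t≤x = inj₁ (t≤x , t≤y ,
    trans (ℤ.i≤j⇒i⊔j≡j (lia 1 (λ r → goal (r :≤ r :+ # 1 :+ # 1 :- # 1)) r₀))
      (lia 1 (λ r → goal (r :+ # 1 :+ # 1 :- # 1 :≡ r :+ # 1)) r₀) ,
    lia 1 (λ r → goal (r :+ # 1 :+ # 1 :≡ r :+ # 2)) r₀)
  ... | yes t≤x | no t≰y rewrite y↓ (ℤ.≰⇒> t≰y) | x↑ t≤x = inj₂ (inj₁ (inj₁ (t≤x , ℤ.≰⇒> t≰y) ,
    ℤ.i≥j⇒i⊔j≡i (lia 1 (λ r → goal (r :+ # 1 :- # 1 :≤ r)) r₀) , refl))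
  ... | no t≰x | yes t≤y rewrite y↑ t≤y | x↓ (ℤ.≰⇒> t≰x) = inj₂ (inj₁ (inj₂ (ℤ.≰⇒> t≰x , t≤y) ,
    ℤ.i≥j⇒i⊔j≡i (lia 1 (λ r → goal (r :+ # 1 :- # 1 :≤ r)) r₀) , refl))
  ... | no t≰x | no t≰y rewrite y↓ (ℤ.≰⇒> t≰y) | x↓ (ℤ.≰⇒> t≰x) = inj₂ (inj₂ (ℤ.≰⇒> t≰x , ℤ.≰⇒> t≰y ,
    ℤ.i≥j⇒i⊔j≡i (lia 1 (λ r → goal (r :- # 1 :≤ r)) r₀) , refl))

  private m = r₀ ⊔ (r₂ - + 1)

  max-above : t ≤ x ⊔ y → r₂ ≡ m + + 1
  max-above t≤ with compare-heights
  ... | inj₁ (_ , _ , eq , eq₂) = lia 3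
    (λ m r r₂ → m :≡ r :+ # 1 ⇒ r₂ :≡ r :+ # 2 ⇒ goal (r₂ :≡ m :+ # 1)) m r₀ r₂ eq eq₂
  ... | inj₂ (inj₁ (_ , eq , eq₂)) = trans eq₂ (cong (_+ + 1) (sym eq))
  ... | inj₂ (inj₂ (x< , y< , _)) = contradiction (⊔-lub-< x< y<) (ℤ.≤⇒≯ t≤)

  max-below : x ⊔ y < t → r₂ ≡ m
  max-below <t with compare-heights
  ... | inj₁ (t≤x , _) = contradiction (ℤ.≤-<-trans (ℤ.i≤i⊔j x y) <t) (ℤ.≤⇒≯ t≤x)
  ... | inj₂ (inj₁ (inj₁ (t≤x , _) , _)) = contradiction (ℤ.≤-<-trans (ℤ.i≤i⊔j x y) <t) (ℤ.≤⇒≯ t≤x)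
  ... | inj₂ (inj₁ (inj₂ (_ , t≤y) , _)) = contradiction (ℤ.≤-<-trans (ℤ.i≤j⊔i x y) <t) (ℤ.≤⇒≯ t≤y)
  ... | inj₂ (inj₂ (_ , _ , eq , eq₂)) = trans eq₂ (sym eq)

  min-above : t ≤ x ⊓ y → m ≡ r₀ + + 1
  min-above t≤ with compare-heights
  ... | inj₁ (_ , _ , eq , _) = eq
  ... | inj₂ (inj₁ (inj₁ (_ , y<) , _)) = contradiction y< (ℤ.≤⇒≯ (ℤ.≤-trans t≤ (ℤ.i⊓j≤j x y)))
  ... | inj₂ (inj₁ (inj₂ (x< , _) , _)) = contradiction x< (ℤ.≤⇒≯ (ℤ.≤-trans t≤ (ℤ.i⊓j≤i x y)))
  ... | inj₂ (inj₂ (x< , _)) = contradiction x< (ℤ.≤⇒≯ (ℤ.≤-trans t≤ (ℤ.i⊓j≤i x y)))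

  min-below : x ⊓ y < t → m ≡ r₀
  min-below <t with compare-heights
  ... | inj₁ (t≤x , t≤y , _) = contradiction <t (ℤ.≤⇒≯ (ℤ.⊓-glb t≤x t≤y))
  ... | inj₂ (inj₁ (_ , eq , _)) = eq
  ... | inj₂ (inj₂ (_ , _ , eq , _)) = eq

-1+1 : ∀ c → c - + 1 + + 1 ≡ c
-1+1 = lia 1 (λ c → goal (c :- # 1 :+ # 1 :≡ c))

+1-1 : ∀ c → c + + 1 - + 1 ≡ c
+1-1 = lia 1 (λ c → goal (c :+ # 1 :- # 1 :≡ c))

step-height : ∀ {f R} α → Height f R → Height (step α f) (stepR α R)
step-height {f} {R} α H = record
  { above = above′ ; below = below′ ; R≥0 = R≥0′ ; R≥c-t = R≥c-t′ }
  where
  open Height H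
  above⁻ : ∀ c t → t ≤ f (c - + 1) → R c t ≡ R (c - + 1) t + + 1
  above⁻ c t h = trans (cong (λ c → R c t) (sym (-1+1 c))) (above (c - + 1) t h)
  below⁻ : ∀ c t → f (c - + 1) < t → R c t ≡ R (c - + 1) t
  below⁻ c t h = trans (cong (λ c → R c t) (sym (-1+1 c))) (below (c - + 1) t h)

  above′ : ∀ c t → t ≤ step α f c → stepR α R (c + + 1) t ≡ stepR α R c t + + 1
  above′ c t h rewrite active-suc α c with active α c
  ... | true = max-above (above⁻ c t) (below⁻ c t) (above c t) (below c t) h
  ... | false rewrite +1-1 c = min-above (above c t) (below c t) (above (c + + 1) t) (below (c + + 1) t) h

  below′ : ∀ c t → step α f c < t → stepR α R (c + + 1) t ≡ stepR α R c t
  below′ c t h rewrite active-suc α c with active α c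
  ... | true = max-below (above⁻ c t) (below⁻ c t) (above c t) (below c t) h
  ... | false rewrite +1-1 c = min-below (above c t) (below c t) (above (c + + 1) t) (below (c + + 1) t) h

  R≥0′ : ∀ c t → + 0 ≤ stepR α R c t
  R≥0′ c t with active α c
  ... | true = ℤ.≤-trans (R≥0 (c - + 1) t) (ℤ.i≤i⊔j _ _)
  ... | false = R≥0 c t

  R≥c-t′ : ∀ c t → c - t ≤ stepR α R c t
  R≥c-t′ c t with active α c
  ... | true = ℤ.≤-trans
    (lia 3 (λ c t r → c :+ # 1 :- t :≤ r ⇒ goal (c :- t :≤ r :- # 1)) c t _ (R≥c-t (c + + 1) t))
    (ℤ.i≤j⊔i _ _)
  ... | false = R≥c-t c t

-- The inactive cuts suffice: a step computes the new value at an active cut from its two inactive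
-- neighbours, and the active cuts are the inactive ones of the next phase. Looking at neighbours
-- costs one unit of the window, as the step gains one unit of the bound.
Bounded : ℤ → Bool → (ℤ → ℤ → ℤ) → Set
Bounded s α R = ∀ c t → active α c ≡ false → t - s ≤ c → c ≤ t + s → R c t + R c t - (c - t) ≤ s

step-bounded : ∀ s α {R} → Bounded (s + + 1) α R → Bounded s (not α) (stepR α R)
step-bounded s α {R} bounded c t inactive t-s≤c c≤t+s rewrite active-not α c with active α c in act
... | false = contradiction inactive (λ ())
... | true = result
  where
  r = R (c - + 1) t
  r′ = R (c + + 1) t
  left : r + r - (c - + 1 - t) ≤ s + + 1
  left = bounded (c - + 1) t (trans (active-pred α c) (cong not act))
    (lia 3 (λ c t s → t :- s :≤ c ⇒ goal (t :- (s :+ # 1) :≤ c :- # 1)) c t s t-s≤c)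
    (lia 3 (λ c t s → c :≤ t :+ s ⇒ goal (c :- # 1 :≤ t :+ (s :+ # 1))) c t s c≤t+s)
  right : r′ + r′ - (c + + 1 - t) ≤ s + + 1
  right = bounded (c + + 1) t (trans (active-suc α c) (cong not act))
    (lia 3 (λ c t s → t :- s :≤ c ⇒ goal (t :- (s :+ # 1) :≤ c :+ # 1)) c t s t-s≤c)
    (lia 3 (λ c t s → c :≤ t :+ s ⇒ goal (c :+ # 1 :≤ t :+ (s :+ # 1))) c t s c≤t+s)
  result : (r ⊔ (r′ - + 1)) + (r ⊔ (r′ - + 1)) - (c - t) ≤ s
  result with ℤ.⊔-sel r (r′ - + 1)
  ... | inj₁ eq rewrite eq = lia 4
    (λ r c t s → r :+ r :- (c :- # 1 :- t) :≤ s :+ # 1 ⇒ goal (r :+ r :- (c :- t) :≤ s)) r c t s left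
  ... | inj₂ eq rewrite eq = lia 4 (λ r c t s → r :+ r :- (c :+ # 1 :- t) :≤ s :+ # 1 ⇒
      goal ((r :- # 1) :+ (r :- # 1) :- (c :- t) :≤ s)) r′ c t s right

diagonal-zero⇒sorted : ∀ {f R} → Height f R → (∀ t → R t t ≤ + 0) → ∀ y → f y ≡ y
diagonal-zero⇒sorted {f} {R} H zero≥ y with f y ℤ.<? y
... | yes < = ⊥-elim (lia 3 (λ y r r′ → r′ :≡ r ⇒ r :≤ # 0 ⇒ y :+ # 1 :- y :≤ r′ ⇒ goal absurd)
  y (R y y) (R (y + + 1) y) (below y y <) (zero≥ y) (R≥c-t (y + + 1) y))
  where open Height H
... | no ≮ with (y + + 1) ℤ.≤? f y
... | yes ≤ = ⊥-elim (lia 2 (λ r r′ → r′ :≡ r :+ # 1 ⇒ r′ :≤ # 0 ⇒ # 0 :≤ r ⇒ goal absurd)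
  (R y (y + + 1)) (R (y + + 1) (y + + 1)) (above y (y + + 1) ≤) (zero≥ (y + + 1)) (R≥0 y (y + + 1)))
  where open Height H
... | no ≰ = lia 2 (λ y z → y :≤ z ⇒ z :< y :+ # 1 ⇒ goal (z :≡ y)) y (f y) (ℤ.≮⇒≥ ≮) (ℤ.≰⇒> ≰)

-- On the diagonal H is even, so H ≤ 1 already means 0 at the cuts which the last step leaves alone.
-- Thus a bound s is worked off in s steps and not in s + 1.
step-diagonal : ∀ α {R} → Bounded (+ 1) α R → ∀ t → stepR α R t t ≤ + 0
step-diagonal α {R} bounded t with active α t in act
... | false = lia 2 (λ r t → r :+ r :- (t :- t) :≤ # 1 ⇒ goal (r :≤ # 0)) (R t t) t
  (bounded t t act (lia 1 (λ t → goal (t :- # 1 :≤ t)) t) (lia 1 (λ t → goal (t :≤ t :+ # 1)) t))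
... | true = ℤ.⊔-lub
  (lia 2 (λ r t → r :+ r :- (t :- # 1 :- t) :≤ # 1 ⇒ goal (r :≤ # 0)) (R (t - + 1) t) t
    (bounded (t - + 1) t (trans (active-pred α t) (cong not act)) ℤ.≤-refl
      (lia 1 (λ t → goal (t :- # 1 :≤ t :+ # 1)) t)))
  (lia 2 (λ r t → r :+ r :- (t :+ # 1 :- t) :≤ # 1 ⇒ goal (r :- # 1 :≤ # 0)) (R (t + + 1) t) t
    (bounded (t + + 1) t (trans (active-suc α t) (cong not act))
      (lia 1 (λ t → goal (t :- # 1 :≤ t :+ # 1)) t) ℤ.≤-refl))

run-sorted : ∀ k α {f R} → Height f R → Bounded (+ suc k) α R → ∀ y → run (suc k) α f y ≡ y
run-sorted zero α {f} {R} H bounded = diagonal-zero⇒sorted (step-height α H) (step-diagonal α {R} bounded)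
run-sorted (suc k) α {f} {R} H bounded = run-sorted k (not α) (step-height α H)
  (step-bounded (+ suc k) α {R} (subst (λ s → Bounded s α R) (cong +_ (ℕ.+-comm 1 (suc k))) bounded))

-- The sort as a sequence of matchings of the cycle

module Routing (m : ℕ) (even : 2 ∣ suc m) where
  private n = suc m
  open Residues n

  odd-shift-even : ∀ k z → odd (z + + (k ℕ.* 2)) ≡ odd z
  odd-shift-even zero z = cong odd (ℤ.+-identityʳ z)
  odd-shift-even (suc k) z = trans
    (cong odd (lia 2 (λ z k → goal (z :+ (# 2 :+ k) :≡ z :+ k :+ # 1 :+ # 1)) z (+ (k ℕ.* 2))))
    (trans (odd-suc (z + + (k ℕ.* 2) + + 1)) (trans (cong not (odd-suc (z + + (k ℕ.* 2))))
      (trans (not-involutive (odd (z + + (k ℕ.* 2)))) (odd-shift-even k z))))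

  odd-periodic : ∀ z → odd (z + N) ≡ odd z
  odd-periodic z = trans (cong (λ n → odd (z + + n)) (_∣_.equality even)) (odd-shift-even (quotient even) z)

  odd-∼ : ∀ {x y} → x ∼ y → odd x ≡ odd y
  odd-∼ {x} {y} = periodic⇒∼ odd odd-periodic {x} {y}

  active-∼ : ∀ α {x y} → x ∼ y → active α x ≡ active α y
  active-∼ true {x} {y} = odd-∼ {x} {y}
  active-∼ false {x} {y} x∼y = cong not (odd-∼ {x} {y} x∼y)

  pos : Fin n → ℤ
  pos v = + toℕ v

  ≡⇒∼ : ∀ {x y} → x ≡ y → x ∼ y
  ≡⇒∼ {x} refl = multiple (+ 0) (sym (ℤ.+-identityʳ x))

  residue-unique : ∀ {a b} → a ℕ.< n → b ℕ.< n → + a ∼ + b → a ≡ b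
  residue-unique {a} {b} a<n b<n (multiple k eq) = ℤ.+-injective (bounded k eq)
    where
    bounded : ∀ k → + a ≡ + b + k * N → + a ≡ + b
    bounded (+ zero) eq = trans eq (ℤ.+-identityʳ (+ b))
    bounded (+ suc k) eq = ⊥-elim
      (lia 4 (λ a b n k → a :< n ⇒ a :≡ b :+ (n :+ k) ⇒ # 0 :≤ b ⇒ # 0 :≤ k ⇒ goal absurd)
      (+ a) (+ b) N (+ (k ℕ.* n)) (ℤ.+<+ a<n) (trans eq (cong (_+_ (+ b)) (sym (ℤ.pos-* (suc k) n))))
        (+≤+ ℕ.z≤n) (+≤+ ℕ.z≤n))
    bounded -[1+ k ] eq = ⊥-elim
      (lia 4 (λ a b n k → b :< n ⇒ a :≡ b :+ :- (n :+ k) ⇒ # 0 :≤ a ⇒ # 0 :≤ k ⇒ goal absurd)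
      (+ a) (+ b) N (+ (k ℕ.* n)) (ℤ.+<+ b<n) (trans eq (cong (_+_ (+ b))
        (trans (sym (ℤ.neg-distribˡ-* (+ suc k) N)) (cong -_ (sym (ℤ.pos-* (suc k) n)))))) (+≤+ ℕ.z≤n)
          (+≤+ ℕ.z≤n))

  pos-injective : ∀ {u v} → pos u ∼ pos v → u ≡ v
  pos-injective {u} {v} u∼v = Fin.toℕ-injective (residue-unique (Fin.toℕ<n u) (Fin.toℕ<n v) u∼v)

  mod-∼ : ∀ k → pos (k ℕ.mod n) ∼ + k
  mod-∼ k = ∼-sym (multiple (+ (k ℕ./ n)) (trans (cong +_ (ℕ.m≡m%n+[m/n]*n k n))
    (cong₂ _+_ (cong +_ (sym (Fin.toℕ-fromℕ< (ℕ.m%n<n k n)))) (ℤ.pos-* (k ℕ./ n) n))))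

  pos-next : ∀ v → pos (next v) ∼ pos v + + 1
  pos-next v = subst (λ x → pos (next v) ∼ + x) (ℕ.+-comm 1 (toℕ v)) (mod-∼ (suc (toℕ v)))

  pos-prev : ∀ v → pos (prev v) ∼ pos v - + 1
  pos-prev v = ∼-trans (mod-∼ (toℕ v ℕ.+ m)) (multiple (+ 1)
    (trans (lia 2 (λ v m → goal (v :+ m :≡ v :- # 1 :+ (# 1 :+ m))) (pos v) (+ m))
      (cong (_+_ (pos v - + 1)) (sym (ℤ.*-identityˡ N)))))

  Periodic : State → Set
  Periodic f = ∀ z → f (z + N) ≡ f z + N

  module _ (f : State) (periodic : Periodic f) where

    displacement-∼ : ∀ {x y} → x ∼ y → f x - x ≡ f y - y
    displacement-∼ = periodic⇒∼ (λ z → f z - z)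
      (λ z → lia 4 (λ a b n z → a :≡ b :+ n ⇒ goal (a :- (z :+ n) :≡ b :- z)) (f (z + N)) (f z) N z
        (periodic z))

    periodic-∼ : ∀ {x y} → x ∼ y → f x ∼ f y
    periodic-∼ {x} {y} x∼y@(multiple k eq) = multiple k
      (lia 5 (λ a b x y kn → a :- x :≡ b :- y ⇒ x :≡ y :+ kn ⇒ goal (a :≡ b :+ kn))
        (f x) (f y) x y (k * N) (displacement-∼ x∼y) eq)

    step-periodic : ∀ α → Periodic (step α f)
    step-periodic α z rewrite active-∼ α {z + N} {z}
      (multiple (+ 1) (cong (_+_ z) (sym (ℤ.*-identityˡ N)))) with active α z
    ... | true = trans (cong₂ _⊔_
      (trans (cong f (lia 2 (λ z n → goal (z :+ n :- # 1 :≡ z :- # 1 :+ n)) z N)) (periodic (z - + 1)))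
      (periodic z))
      (sym (ℤ.mono-≤-distrib-⊔ {f = _+ N} (ℤ.+-monoˡ-≤ N) (f (z - + 1)) (f z)))
    ... | false = trans
      (cong₂ _⊓_ (periodic z)
      (trans (cong f (lia 2 (λ z n → goal (z :+ n :+ # 1 :≡ z :+ # 1 :+ n)) z N)) (periodic (z + + 1))))
      (sym (ℤ.mono-≤-distrib-⊓ {f = _+ N} (ℤ.+-monoˡ-≤ N) (f z) (f (z + + 1))))

  module _ (f : State) (periodic : Periodic f) where

    -- The edge with index z joins z and z + 1, so it belongs to the cut at z + 1, whose parity
    -- decides whether it is compared.
    swapped : Bool → ℤ → Bool
    swapped α z = active α (z + + 1) ∧ does (f (z + + 1) ℤ.<? f z)

    swapped-∼ : ∀ α {x y} → x ∼ y → swapped α x ≡ swapped α y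
    swapped-∼ α {x} {y} x∼y = cong₂ _∧_ (active-∼ α (∼-shift {x} {y} (+ 1) x∼y)) same
      where
      d = displacement-∼ f periodic x∼y
      d′ = displacement-∼ f periodic (∼-shift {x} {y} (+ 1) x∼y)
      same : does (f (x + + 1) ℤ.<? f x) ≡ does (f (y + + 1) ℤ.<? f y)
      same with f (y + + 1) ℤ.<? f y
      ... | yes < = dec-true (f (x + + 1) ℤ.<? f x)
          (lia 6 (λ a b x a′ b′ y → a :- x :≡ a′ :- y ⇒ b :- (x :+ # 1) :≡ b′ :- (y :+ # 1) ⇒
          b′ :< a′ ⇒ goal (b :< a)) (f x) (f (x + + 1)) x (f y) (f (y + + 1)) y d d′ <)
      ... | no ≮ = dec-false (f (x + + 1) ℤ.<? f x)
          (λ < → ≮ (lia 6 (λ a b x a′ b′ y → a :- x :≡ a′ :- y ⇒ b :- (x :+ # 1) :≡ b′ :- (y :+ # 1) ⇒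
          b :< a ⇒ goal (b′ :< a′)) (f x) (f (x + + 1)) x (f y) (f (y + + 1)) y d d′ <))

    swapped⇒active : ∀ α {z} → swapped α z ≡ true → active α (z + + 1) ≡ true
    swapped⇒active α {z} eq with active α (z + + 1)
    ... | true = refl

    swapped⇒< : ∀ α {z} → swapped α z ≡ true → f (z + + 1) < f z
    swapped⇒< α {z} eq with active α (z + + 1) | f (z + + 1) ℤ.<? f z
    ... | true | yes < = <

    ¬swapped⇒≤ : ∀ α {z} → active α (z + + 1) ≡ true → swapped α z ≡ false → f z ≤ f (z + + 1)
    ¬swapped⇒≤ α {z} act eq with active α (z + + 1) | f (z + + 1) ℤ.<? f z
    ... | true | no ≮ = ℤ.≮⇒≥ ≮

    matching : Bool → Matching n
    matching α = record { edges = tabulate (λ e → swapped α (pos e)) ; isMatching = matches }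
      where
      member : ∀ e → e ∈ tabulate (λ e → swapped α (pos e)) → swapped α (pos e) ≡ true
      member e e∈ = trans (sym (lookup∘tabulate (λ e → swapped α (pos e)) e)) ([]=⇒lookup e∈)
      -- Consecutive edges belong to cuts of different parity, also across the wrap-around, because
      -- n is even.
      not-adjacent : ∀ e e′ → swapped α (pos e) ≡ true → swapped α (pos e′) ≡ true → e ≢ next e′
      not-adjacent e e′ s s′ refl with () ← trans
        (trans (sym (swapped⇒active α s)) (active-suc α (pos e)))
        (cong not (trans (active-∼ α (pos-next e′)) (swapped⇒active α s′)))
      matches : IsMatching (tabulate (λ e → swapped α (pos e)))
      matches v e e′ e∈ e′∈ (inj₁ refl) (inj₁ refl) = refl
      matches v e e′ e∈ e′∈ (inj₁ refl) (inj₂ eq) = ⊥-elim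
        (not-adjacent e e′ (member e e∈) (member e′ e′∈) eq)
      matches v e e′ e∈ e′∈ (inj₂ eq) (inj₁ refl) = ⊥-elim
        (not-adjacent e′ e (member e′ e′∈) (member e e∈) eq)
      matches v e e′ e∈ e′∈ (inj₂ refl) (inj₂ eq) = pos-injective
        (subst₂ _∼_ (+1-1 (pos e)) (+1-1 (pos e′)) (∼-shift {pos e + + 1} {pos e′ + + 1} (- + 1)
          (∼-trans (∼-sym (pos-next e)) (∼-trans (≡⇒∼ (cong pos eq)) (pos-next e′)))))

    step-∼ : ∀ {α x y} → x ∼ y → step α f x ∼ step α f y
    step-∼ {α} = periodic-∼ (step α f) (step-periodic f periodic α)

    move-matching : ∀ α v → move (matching α) v ≡
      (if swapped α (pos v) then next v else if swapped α (pos v - + 1) then prev v else v)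
    move-matching α v = cong₂ (λ b b′ → if b then next v else if b′ then prev v else v)
      (lookup∘tabulate (λ e → swapped α (pos e)) v)
      (trans (lookup∘tabulate (λ e → swapped α (pos e)) (prev v))
        (swapped-∼ α {pos (prev v)} {pos v - + 1} (pos-prev v)))

    -- A swap happens exactly where `step` exchanges two values, so a pebble finds its own
    -- destination at its new vertex. The two values agree only modulo N, since `next` and `prev`
    -- wrap around.
    move-step : ∀ α v → step α f (pos (move (matching α) v)) ∼ f (pos v)
    move-step α v rewrite move-matching α v
      with swapped α (pos v) in s | swapped α (pos v - + 1) in s′
    ... | true | _ = ∼-trans (step-∼ {α} {pos (next v)} {pos v + + 1} (pos-next v)) (≡⇒∼ to-right)
      where
      to-right : step α f (pos v + + 1) ≡ f (pos v)
      to-right rewrite swapped⇒active α s | +1-1 (pos v) = ℤ.i≥j⇒i⊔j≡i (ℤ.<⇒≤ (swapped⇒< α s))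
    ... | false | true = ∼-trans (step-∼ {α} {pos (prev v)} {pos v - + 1} (pos-prev v)) (≡⇒∼ to-left)
      where
      inactive : active α (pos v - + 1) ≡ false
      inactive = trans (active-pred α (pos v))
        (cong not (trans (cong (active α) (sym (-1+1 (pos v)))) (swapped⇒active α s′)))
      to-left : step α f (pos v - + 1) ≡ f (pos v)
      to-left rewrite inactive = trans (ℤ.i≥j⇒i⊓j≡j (ℤ.<⇒≤ (swapped⇒< α s′))) (cong f (-1+1 (pos v)))
    ... | false | false = ≡⇒∼ stays
      where
      stays : step α f (pos v) ≡ f (pos v)
      stays with active α (pos v) in act
      ... | true = ℤ.i≤j⇒i⊔j≡j (subst (λ z → f (pos v - + 1) ≤ f z) (-1+1 (pos v))
        (¬swapped⇒≤ α (trans (cong (active α) (-1+1 (pos v))) act) s′))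
      ... | false = ℤ.i≤j⇒i⊓j≡i (¬swapped⇒≤ α (trans (active-suc α (pos v)) (cong not act)) s)

  matchings : ∀ k α f → Periodic f → Vec (Matching n) k
  matchings zero α f periodic = []
  matchings (suc k) α f periodic =
    matching f periodic α ∷ matchings k (not α) (step α f) (step-periodic f periodic α)

  route-run : ∀ k α f (periodic : Periodic f) v → run k α f (pos (route (matchings k α f periodic) v)) ∼ f
    (pos v)
  route-run zero α f periodic v = ≡⇒∼ refl
  route-run (suc k) α f periodic v = ∼-trans {z = f (pos v)}
    (route-run k (not α) (step α f) (step-periodic f periodic α) (move (matching f periodic α) v))
    (move-step f periodic α v)

  routable : ∀ (π : Permutation′ n) f R → Periodic f → (∀ v → f (pos v) ∼ pos (π ⟨$⟩ʳ v)) → Height f R →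
    ∀ k α → Bounded (+ suc k) α R → RoutableIn π (suc k)
  routable π f R periodic destination height k α bounded = matchings (suc k) α f periodic , λ v →
    pos-injective
    (∼-trans (≡⇒∼ (sym (run-sorted k α height bounded _)))
      (∼-trans (route-run (suc k) α f periodic v) (destination v)))

-- Lifting a permutation to the line

ι : Bool → ℤ
ι true = + 1
ι false = + 0

ι-bounds : ∀ β → + 0 ≤ ι β × ι β ≤ + 1
ι-bounds true = +≤+ ℕ.z≤n , ℤ.≤-refl
ι-bounds false = ℤ.≤-refl , +≤+ ℕ.z≤n

Σ< : ℕ → (ℕ → ℤ) → ℤ
Σ< zero h = + 0
Σ< (suc k) h = Σ< k h + h k

Σ<-cong : ∀ k {g h} → (∀ j → j ℕ.< k → g j ≡ h j) → Σ< k g ≡ Σ< k h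
Σ<-cong zero eq = refl
Σ<-cong (suc k) eq = cong₂ _+_ (Σ<-cong k (λ j j<k → eq j (ℕ.m<n⇒m<1+n j<k))) (eq k ℕ.≤-refl)

Σ<-split : ∀ a k h → Σ< (a ℕ.+ k) h ≡ Σ< a h + Σ< k (λ j → h (a ℕ.+ j))
Σ<-split a zero h rewrite ℕ.+-identityʳ a = sym (ℤ.+-identityʳ _)
Σ<-split a (suc k) h rewrite ℕ.+-suc a k | Σ<-split a k h = ℤ.+-assoc (Σ< a h) (Σ< k (λ j → h (a ℕ.+ j)))
  (h (a ℕ.+ k))

Σ<-update : ∀ k {g h} i → i ℕ.< k → (∀ j → j ℕ.< k → j ≢ i → g j ≡ h j) → Σ< k g + h i ≡ Σ< k h + g i
Σ<-update (suc k) {g} {h} i i<1+k eq with i ℕ.≟ k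
... | yes refl = trans
  (cong (λ s → s + g k + h k) (Σ<-cong k (λ j j<k → eq j (ℕ.m<n⇒m<1+n j<k) (ℕ.<⇒≢ j<k))))
  (lia 3 (λ s g h → goal (s :+ g :+ h :≡ s :+ h :+ g)) (Σ< k h) (g k) (h k))
... | no i≢k = lia 6
  (λ s s′ g h gk hk → s :+ h :≡ s′ :+ g ⇒ gk :≡ hk ⇒ goal (s :+ gk :+ h :≡ s′ :+ hk :+ g))
  (Σ< k g) (Σ< k h) (g i) (h i) (g k) (h k)
  (Σ<-update k i (ℕ.≤∧≢⇒< (ℕ.≤-pred i<1+k) i≢k) (λ j j<k → eq j (ℕ.m<n⇒m<1+n j<k)))
  (eq k ℕ.≤-refl (≢-sym i≢k))

Σ<-+ : ∀ k g h → Σ< k (λ j → g j + h j) ≡ Σ< k g + Σ< k h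
Σ<-+ zero g h = refl
Σ<-+ (suc k) g h rewrite Σ<-+ k g h =
  lia 4 (λ a b c d → goal (a :+ b :+ (c :+ d) :≡ a :+ c :+ (b :+ d))) (Σ< k g) (Σ< k h) (g k) (h k)

Σ<-1 : ∀ k → Σ< k (λ _ → + 1) ≡ + k
Σ<-1 zero = refl
Σ<-1 (suc k) rewrite Σ<-1 k = cong +_ (ℕ.+-comm k 1)

clamp : ℤ → ℕ
clamp (+ k) = k
clamp -[1+ _ ] = 0

clamp-≤0 : ∀ {z} → z ≤ + 0 → clamp z ≡ 0
clamp-≤0 {+ zero} _ = refl
clamp-≤0 {+ suc _} (+≤+ ())
clamp-≤0 { -[1+ _ ]} _ = refl

module Lifting (m : ℕ) (even : 2 ∣ suc m) (π : Permutation′ (suc m)) where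
  private n = suc m
  open Residues n
  open Routing m even

  cls : ℤ → Fin n
  cls z = Fin.fromℕ< (ℤ.n%ℕd<d z n)

  pos-cls : ∀ z → pos (cls z) ∼ z
  pos-cls z = ∼-sym (multiple (z ℤ./ℕ n) (trans (ℤ.a≡a%ℕn+[a/ℕn]*n z n)
    (cong (λ r → + r + z ℤ./ℕ n * N) (sym (Fin.toℕ-fromℕ< (ℤ.n%ℕd<d z n))))))

  cls-∼ : ∀ {x y} → x ∼ y → cls x ≡ cls y
  cls-∼ {x} {y} x∼y = pos-injective (∼-trans (pos-cls x) (∼-trans x∼y (∼-sym (pos-cls y))))

  cls-pos : ∀ v → cls (pos v) ≡ v
  cls-pos v = pos-injective (pos-cls (pos v))

  cls-+N : ∀ z → cls (z + N) ≡ cls z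
  cls-+N z = cls-∼ {z + N} {z} (multiple (+ 1) (cong (_+_ z) (sym (ℤ.*-identityˡ N))))

  scale : Bool → ℤ
  scale b = if b then N else + 0

  wraps : Fin n → Bool
  wraps v = does (pos (π ⟨$⟩ʳ v) ℤ.<? pos v)

  -- The distance from v to π v in the direction of next.
  e : Fin n → ℤ
  e v = pos (π ⟨$⟩ʳ v) - pos v + scale (wraps v)

  pos<N : ∀ v → pos v < N
  pos<N v = ℤ.+<+ (Fin.toℕ<n v)

  0≤pos : ∀ v → + 0 ≤ pos v
  0≤pos v = +≤+ ℕ.z≤n

  e≥0 : ∀ v → + 0 ≤ e v
  e≥0 v with pos (π ⟨$⟩ʳ v) ℤ.<? pos v
  ... | yes < rewrite dec-true (pos (π ⟨$⟩ʳ v) ℤ.<? pos v) < =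
    lia 3 (λ p v n → # 0 :≤ p ⇒ v :< n ⇒ goal (# 0 :≤ p :- v :+ n)) (pos (π ⟨$⟩ʳ v)) (pos v) N
      (0≤pos (π ⟨$⟩ʳ v)) (pos<N v)
  ... | no ≮ rewrite dec-false (pos (π ⟨$⟩ʳ v) ℤ.<? pos v) ≮ =
    lia 2 (λ p v → v :≤ p ⇒ goal (# 0 :≤ p :- v :+ # 0)) (pos (π ⟨$⟩ʳ v)) (pos v) (ℤ.≮⇒≥ ≮)

  e<N : ∀ v → e v < N
  e<N v with pos (π ⟨$⟩ʳ v) ℤ.<? pos v
  ... | yes < rewrite dec-true (pos (π ⟨$⟩ʳ v) ℤ.<? pos v) < =
    lia 3 (λ p v n → p :< v ⇒ goal (p :- v :+ n :< n)) (pos (π ⟨$⟩ʳ v)) (pos v) N <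
  ... | no ≮ rewrite dec-false (pos (π ⟨$⟩ʳ v) ℤ.<? pos v) ≮ =
    lia 3 (λ p v n → p :< n ⇒ # 0 :≤ v ⇒ goal (p :- v :+ # 0 :< n)) (pos (π ⟨$⟩ʳ v)) (pos v) N
      (pos<N (π ⟨$⟩ʳ v)) (0≤pos v)

  -- A lift has total displacement 0 if count b = count wraps.
  count : (Fin n → Bool) → ℤ
  count b = Σ< n (λ j → ι (b (cls (+ j))))

  scale-∼ : ∀ b x → x + scale b ∼ x
  scale-∼ true x = multiple (+ 1) (cong (_+_ x) (sym (ℤ.*-identityˡ N)))
  scale-∼ false x = multiple (+ 0) refl

  module Displacement (b : Fin n → Bool) where

    D : ℤ → ℤ
    D z = e (cls z) - scale (b (cls z))

    f : State
    f z = z + D z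

    D-periodic : ∀ z → D (z + N) ≡ D z
    D-periodic z = cong (λ v → e v - scale (b v)) (cls-+N z)

    f-periodic : Periodic f
    f-periodic z = trans (cong (_+_ (z + N)) (D-periodic z))
      (lia 3 (λ z d n → goal (z :+ n :+ d :≡ z :+ d :+ n)) z (D z) N)

    D<N : ∀ z → D z < N
    D<N z with b (cls z)
    ... | true = lia 2 (λ e n → e :< n ⇒ # 0 :< n ⇒ goal (e :- n :< n)) (e (cls z)) N (e<N (cls z))
      (ℤ.+<+ ℕ.z<s)
    ... | false = lia 2 (λ e n → e :< n ⇒ goal (e :- # 0 :< n)) (e (cls z)) N (e<N (cls z))

    D≥-N : ∀ z → - N ≤ D z
    D≥-N z with b (cls z)
    ... | true = lia 2 (λ e n → # 0 :≤ e ⇒ goal (:- n :≤ e :- n)) (e (cls z)) N (e≥0 (cls z))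
    ... | false = lia 2 (λ e n → # 0 :≤ e ⇒ # 0 :≤ n ⇒ goal (:- n :≤ e :- # 0)) (e (cls z)) N (e≥0 (cls z))
      (+≤+ ℕ.z≤n)

    f-destination : ∀ z → f z ∼ pos (π ⟨$⟩ʳ cls z)
    f-destination z = ∼-trans start (∼-trans (∼-sym (scale-∼ β (p + scale w - scale β)))
      (∼-trans (≡⇒∼ (lia 3 (λ p w β → goal (p :+ w :- β :+ β :≡ p :+ w)) p (scale w) (scale β)))
        (scale-∼ w p)))
      where
      v = cls z
      p = pos (π ⟨$⟩ʳ v)
      w = wraps v
      β = b v
      start : f z ∼ p + scale w - scale β
      start = subst (f z ∼_)
        (lia 4 (λ v p w β → goal (v :+ (p :- v :+ w :- β) :≡ p :+ w :- β)) (pos v) p (scale w) (scale β))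
        (∼-shift {z} {pos v} (D z) (∼-sym (pos-cls z)))

    f-destination-pos : ∀ v → f (pos v) ∼ pos (π ⟨$⟩ʳ v)
    f-destination-pos v = subst (λ u → f (pos v) ∼ pos (π ⟨$⟩ʳ u)) (cls-pos v) (f-destination (pos v))

    f-injective : ∀ x y → f x ≡ f y → x ≡ y
    f-injective x y eq = lia 4 (λ x y d d′ → x :+ d :≡ y :+ d′ ⇒ d :≡ d′ ⇒ goal (x :≡ y)) x y (D x) (D y) eq
      (cong (λ v → e v - scale (b v)) same)
      where
      same : cls x ≡ cls y
      same = trans (sym (inverseˡ π)) (trans (cong (π ⟨$⟩ˡ_) (pos-injective
        (∼-trans (∼-sym (f-destination x))
          (∼-trans (≡⇒∼ eq) (f-destination y))))) (inverseˡ π))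

    f-surjective : ∀ t → ∃ λ y → f y ≡ t
    f-surjective t = pos v + k * N , trans
        (lia 4 (λ v kn d d′ → d′ :≡ d ⇒ goal (v :+ kn :+ d′ :≡ v :+ d :+ kn))
        (pos v) (k * N) (D (pos v)) (D (pos v + k * N))
          (periodic⇒∼ D D-periodic {pos v + k * N} {pos v} (multiple k refl))) (sym eq)
      where
      v = π ⟨$⟩ˡ cls t
      t∼ : t ∼ f (pos v)
      t∼ = ∼-trans (∼-sym (pos-cls t))
        (subst (λ u → pos u ∼ f (pos v)) (inverseʳ π) (∼-sym (f-destination-pos v)))
      k = _∼_.factor t∼
      eq = _∼_.equation t∼

    counted : ℤ → ℕ → ℤ
    counted t j = ι (does (t ℤ.≤? f (t - N + + j)))

    -- The number of y < c with t ≤ f y: since D < N they satisfy t - N ≤ y.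
    R : ℤ → ℤ → ℤ
    R c t = Σ< (clamp (c - t + N)) (counted t)

    R-far : ∀ {c t} → c ≤ t - N → R c t ≡ + 0
    R-far {c} {t} c≤ = cong (λ k → Σ< k (counted t))
      (clamp-≤0 (lia 3 (λ c t n → c :≤ t :- n ⇒ goal (c :- t :+ n :≤ # 0)) c t N c≤))

    R-suc : ∀ c t → R (c + + 1) t ≡ R c t + ι (does (t ℤ.≤? f c))
    R-suc c t with c - t + N in eq
    ... | + k = trans (cong (λ z → Σ< (clamp z) (counted t)) next-index)
      (cong (λ z → Σ< k (counted t) + ι (does (t ℤ.≤? f z)))
        (lia 4 (λ c t n k → c :- t :+ n :≡ k ⇒ goal (t :- n :+ k :≡ c)) c t N (+ k) eq))
      where
      next-index : c + + 1 - t + N ≡ + suc k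
      next-index = lia 4 (λ c t n k → c :- t :+ n :≡ k ⇒ goal (c :+ # 1 :- t :+ n :≡ # 1 :+ k)) c t N
        (+ k) eq
    ... | -[1+ k ] = trans
      (R-far {c + + 1} {t} (lia 3 (λ c t n → c :- t :+ n :< # 0 ⇒ goal (c :+ # 1 :≤ t :- n)) c t N neg))
      (sym (cong (λ β → + 0 + ι β)
        (dec-false (t ℤ.≤? f c)
        (λ t≤ → lia 4 (λ c t n d → t :≤ c :+ d ⇒ d :< n ⇒ c :- t :+ n :< # 0 ⇒ goal absurd)
        c t N (D c) t≤ (D<N c) neg))))
      where
      neg : c - t + N < + 0
      neg = subst (_< + 0) (sym eq) ℤ.-<+

    R-above : ∀ c t → t ≤ f c → R (c + + 1) t ≡ R c t + + 1
    R-above c t t≤ = trans (R-suc c t) (cong (λ b → R c t + ι b) (dec-true (t ℤ.≤? f c) t≤))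

    R-below : ∀ c t → f c < t → R (c + + 1) t ≡ R c t
    R-below c t < = trans (R-suc c t)
      (trans (cong (λ b → R c t + ι b) (dec-false (t ℤ.≤? f c) (ℤ.<⇒≱ <))) (ℤ.+-identityʳ (R c t)))

    Σ-counted≥0 : ∀ t k → + 0 ≤ Σ< k (counted t)
    Σ-counted≥0 t zero = ℤ.≤-refl
    Σ-counted≥0 t (suc k) with does (t ℤ.≤? f (t - N + + k))
    ... | true = ℤ.≤-trans (Σ-counted≥0 t k) (ℤ.i≤i+j _ (+ 1))
    ... | false = ℤ.≤-trans (Σ-counted≥0 t k) (ℤ.i≤i+j _ (+ 0))

    R≥0 : ∀ c t → + 0 ≤ R c t
    R≥0 c t = Σ-counted≥0 t (clamp (c - t + N))

    R-existsAbove : ∀ c t → + 0 < R c t → ∃ λ y → y < c × t ≤ f y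
    R-existsAbove c t 0<R with c - t + N in eq
    ... | -[1+ _ ] = contradiction 0<R (ℤ.<-irrefl refl)
    ... | + k = let j , j<k , t≤ = search k 0<R in t - N + + j ,
      lia 5 (λ c t n k j → c :- t :+ n :≡ k ⇒ j :< k ⇒ goal (t :- n :+ j :< c)) c t N (+ k) (+ j) eq
        (ℤ.+<+ j<k) , t≤
      where
      search : ∀ k → + 0 < Σ< k (counted t) → ∃ λ j → j ℕ.< k × t ≤ f (t - N + + j)
      search zero 0<0 = contradiction 0<0 (ℤ.<-irrefl refl)
      search (suc k) 0<Σ with t ℤ.≤? f (t - N + + k)
      ... | yes t≤ = k , ℕ.≤-refl , t≤
      ... | no _ = let j , j<k , t≤ = search k (subst (+ 0 <_) (ℤ.+-identityʳ _) 0<Σ) in j ,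
        ℕ.m<n⇒m<1+n j<k , t≤

    -- Only the pebble from y is headed for t, so a higher threshold loses it if it starts before c.
    -- The sums on the two sides run over windows that begin at t - N and at t + 1 - N; hence the
    -- induction on c, starting at t - N, where both vanish.
    R-raise : ∀ t y → f y ≡ t → ∀ c → R c t ≡ R c (t + + 1) + ι (does (y ℤ.<? c))
    R-raise t y fy≡t c with c ℤ.≤? t - N
    ... | yes c≤ = far c c≤
      where
      far : ∀ c → c ≤ t - N → R c t ≡ R c (t + + 1) + ι (does (y ℤ.<? c))
      far c c≤ = trans (R-far {c} {t} c≤) (sym (cong₂ (λ r β → r + ι β)
        (R-far {c} {t + + 1} (lia 3 (λ c t n → c :≤ t :- n ⇒ goal (c :≤ t :+ # 1 :- n)) c t N c≤))
        (dec-false (y ℤ.<? c)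
          (λ y<c → lia 5 (λ c t n y d → c :≤ t :- n ⇒ y :< c ⇒ y :+ d :≡ t ⇒ d :< n ⇒ goal absurd)
          c t N y (D y) c≤ y<c fy≡t (D<N y)))))
    ... | no c≰ = ascend {λ c → R c t ≡ R c (t + + 1) + ι (does (y ℤ.<? c))} (t - N) base grow c
      (ℤ.<⇒≤ (ℤ.≰⇒> c≰))
      where
      base : R (t - N) t ≡ R (t - N) (t + + 1) + ι (does (y ℤ.<? (t - N)))
      base = trans (R-far {t - N} {t} ℤ.≤-refl) (sym (cong₂ (λ r β → r + ι β)
        (R-far {t - N} {t + + 1} (lia 2 (λ t n → goal (t :- n :≤ t :+ # 1 :- n)) t N))
        (dec-false (y ℤ.<? (t - N))
          (λ y<c → lia 4 (λ t n y d → y :< t :- n ⇒ y :+ d :≡ t ⇒ d :< n ⇒ goal absurd)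
          t N y (D y) y<c fy≡t (D<N y)))))
      grow : ∀ c → t - N ≤ c → R c t ≡ R c (t + + 1) + ι (does (y ℤ.<? c)) →
        R (c + + 1) t ≡ R (c + + 1) (t + + 1) + ι (does (y ℤ.<? (c + + 1)))
      grow c _ IH with c ℤ.≟ y
      ... | yes refl rewrite dec-true (c ℤ.<? (c + + 1)) (lia 1 (λ c → goal (c :< c :+ # 1)) c)
                           | dec-false (c ℤ.<? c) (ℤ.<-irrefl refl) =
        lia 4 (λ r r′ s s′ → r′ :≡ r :+ # 1 ⇒ s′ :≡ s ⇒ r :≡ s :+ # 0 ⇒ goal (r′ :≡ s′ :+ # 1))
          (R c t) (R (c + + 1) t) (R c (t + + 1)) (R (c + + 1) (t + + 1))
          (R-above c t (ℤ.≤-reflexive (sym fy≡t)))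
          (R-below c (t + + 1) (subst (_< t + + 1) (sym fy≡t) (lia 1 (λ c → goal (c :< c :+ # 1)) t))) IH
      ... | no c≢y = lia 5 (λ r r′ s s′ i → r′ :- r :≡ s′ :- s ⇒ r :≡ s :+ i ⇒ goal (r′ :≡ s′ :+ i))
          (R c t) (R (c + + 1) t) (R c (t + + 1)) (R (c + + 1) (t + + 1))
            (ι (does (y ℤ.<? (c + + 1)))) increments
          (trans IH (cong (λ β → R c (t + + 1) + ι β) same-side))
        where
        same-side : does (y ℤ.<? c) ≡ does (y ℤ.<? (c + + 1))
        same-side with y ℤ.<? c
        ... | yes y<c = sym
          (dec-true (y ℤ.<? (c + + 1)) (ℤ.<-trans y<c (lia 1 (λ c → goal (c :< c :+ # 1)) c)))
        ... | no y≮c = sym (dec-false (y ℤ.<? (c + + 1)) (λ y<c+1 → c≢y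
          (lia 2 (λ c y → c :≤ y ⇒ y :< c :+ # 1 ⇒ goal (c :≡ y)) c y (ℤ.≮⇒≥ y≮c) y<c+1)))
        increments : R (c + + 1) t - R c t ≡ R (c + + 1) (t + + 1) - R c (t + + 1)
        increments with (t + + 1) ℤ.≤? f c
        ... | yes t+1≤ = lia 4 (λ r r′ s s′ → r′ :≡ r :+ # 1 ⇒ s′ :≡ s :+ # 1 ⇒ goal (r′ :- r :≡ s′ :- s))
          (R c t) (R (c + + 1) t) (R c (t + + 1)) (R (c + + 1) (t + + 1))
          (R-above c t (ℤ.≤-trans (ℤ.i≤i+j t (+ 1)) t+1≤)) (R-above c (t + + 1) t+1≤)
        ... | no t+1≰ = lia 4 (λ r r′ s s′ → r′ :≡ r ⇒ s′ :≡ s ⇒ goal (r′ :- r :≡ s′ :- s))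
          (R c t) (R (c + + 1) t) (R c (t + + 1)) (R (c + + 1) (t + + 1))
          (R-below c t (ℤ.≤∧≢⇒< (lia 2 (λ t z → z :< t :+ # 1 ⇒ goal (z :≤ t)) t (f c) (ℤ.≰⇒> t+1≰))
            (λ fc≡t → c≢y (f-injective c y (trans fc≡t (sym fy≡t))))))
          (R-below c (t + + 1) (ℤ.≰⇒> t+1≰))

    -- Lifts of total displacement 0

    module _ (balanced : count b ≡ count wraps) where

      -- x - N and x are the destinations of the two lifts starting in [- N , N).
      lifts≥0 : ∀ p w β {x} → + 0 ≤ p → p < N → x ≡ p + scale w - scale β →
        ι (does (+ 0 ℤ.≤? (x - N))) + ι (does (+ 0 ℤ.≤? x)) + ι β ≡ + 1 + ι w
      lifts≥0 p true true {x} 0≤p p<N eq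
        rewrite dec-false (+ 0 ℤ.≤? (x - N))
              (λ h → lia 3 (λ x p n → x :≡ p :+ n :- n ⇒ p :< n ⇒ # 0 :≤ x :- n ⇒
              goal absurd) x p N eq p<N h)
              | dec-true (+ 0 ℤ.≤? x)
                (lia 3 (λ x p n → x :≡ p :+ n :- n ⇒ # 0 :≤ p ⇒ goal (# 0 :≤ x)) x p N eq 0≤p) = refl
      lifts≥0 p false false {x} 0≤p p<N eq
        rewrite dec-false (+ 0 ℤ.≤? (x - N))
              (λ h → lia 3 (λ x p n → x :≡ p :+ # 0 :- # 0 ⇒ p :< n ⇒ # 0 :≤ x :- n ⇒
              goal absurd) x p N eq p<N h)
              | dec-true (+ 0 ℤ.≤? x)
                (lia 3 (λ x p n → x :≡ p :+ # 0 :- # 0 ⇒ # 0 :≤ p ⇒ goal (# 0 :≤ x)) x p N eq 0≤p) = refl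
      lifts≥0 p true false {x} 0≤p p<N eq
        rewrite dec-true (+ 0 ℤ.≤? (x - N))
              (lia 3 (λ x p n → x :≡ p :+ n :- # 0 ⇒ # 0 :≤ p ⇒ goal (# 0 :≤ x :- n)) x p N eq 0≤p)
              | dec-true (+ 0 ℤ.≤? x)
                (lia 3 (λ x p n → x :≡ p :+ n :- # 0 ⇒ # 0 :≤ p ⇒ p :< n ⇒
                goal (# 0 :≤ x)) x p N eq 0≤p p<N) = refl
      lifts≥0 p false true {x} 0≤p p<N eq
        rewrite dec-false (+ 0 ℤ.≤? (x - N))
              (λ h → lia 3 (λ x p n → x :≡ p :+ # 0 :- n ⇒ p :< n ⇒ # 0 :≤ p ⇒ # 0 :≤ x :- n ⇒
              goal absurd) x p N eq p<N 0≤p h)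
              | dec-false (+ 0 ℤ.≤? x)
                (λ h → lia 3 (λ x p n → x :≡ p :+ # 0 :- n ⇒ p :< n ⇒ # 0 :≤ x ⇒
                goal absurd) x p N eq p<N h) = refl

      counted-pair : ∀ j → j ℕ.< n →
        counted (+ 0) j + counted (+ 0) (n ℕ.+ j) + ι (b (cls (+ j))) ≡ + 1 + ι (wraps (cls (+ j)))
      counted-pair j j<n = trans
        (cong₂ (λ x y → ι (does (+ 0 ℤ.≤? x)) + ι (does (+ 0 ℤ.≤? y)) + ι (b v)) first second)
        (lifts≥0 (pos (π ⟨$⟩ʳ v)) (wraps v) (b v) (0≤pos (π ⟨$⟩ʳ v)) (pos<N (π ⟨$⟩ʳ v)) value)
        where
        v = cls (+ j)
        pos-v : pos v ≡ + j
        pos-v = cong +_ (residue-unique (Fin.toℕ<n v) j<n (pos-cls (+ j)))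
        first : f (+ 0 - N + + j) ≡ f (+ j) - N
        first = lia 3 (λ a b n → b :≡ a :+ n ⇒ goal (a :≡ b :- n)) (f (+ 0 - N + + j)) (f (+ j)) N
          (trans (cong f (lia 2 (λ j n → goal (j :≡ # 0 :- n :+ j :+ n)) (+ j) N))
            (f-periodic (+ 0 - N + + j)))
        second : f (+ 0 - N + + (n ℕ.+ j)) ≡ f (+ j)
        second = cong f (lia 2 (λ j n → goal (# 0 :- n :+ (n :+ j) :≡ j)) (+ j) N)
        value : f (+ j) ≡ pos (π ⟨$⟩ʳ v) + scale (wraps v) - scale (b v)
        value = lia 5 (λ j v p w β → v :≡ j ⇒ goal (j :+ (p :- v :+ w :- β) :≡ p :+ w :- β))
          (+ j) (pos v) (pos (π ⟨$⟩ʳ v)) (scale (wraps v)) (scale (b v)) pos-v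

      -- Balance enters here: of the two lifts of a vertex in [- N , N), 1 + `wraps` - `b` have a
      -- non-negative destination, and the last two terms cancel in the sum over all vertices.
      R-far-right₀ : R (+ 0 + N) (+ 0) ≡ N
      R-far-right₀ = trans (cong (λ k → Σ< k (counted (+ 0))) (cong clamp
          (lia 1 (λ n → goal (# 0 :+ n :- # 0 :+ n :≡ n :+ n)) N)))
        (trans (Σ<-split n n (counted (+ 0)))
          (lia 5 (λ a b c d e → a :+ b :+ c :≡ e :+ d ⇒ c :≡ d ⇒ goal (a :+ b :≡ e))
            (Σ< n (counted (+ 0))) (Σ< n (λ j → counted (+ 0) (n ℕ.+ j))) (count b)
              (count wraps) N total balanced))
        where
        total : Σ< n (counted (+ 0)) + Σ< n (λ j → counted (+ 0) (n ℕ.+ j)) + count b ≡ N + count wraps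
        total = trans (cong (_+ count b) (sym (Σ<-+ n _ _))) (trans (sym (Σ<-+ n _ _))
          (trans (Σ<-cong n counted-pair)
            (trans (Σ<-+ n (λ _ → + 1) (λ j → ι (wraps (cls (+ j))))) (cong (_+ count wraps) (Σ<-1 n)))))

      R-raise-right : ∀ t → R (t + + 1 + N) t ≡ R (t + + 1 + N) (t + + 1) + + 1
      R-raise-right t with f-surjective t
      ... | y , fy≡t = trans (R-raise t y fy≡t (t + + 1 + N)) (cong (λ β → R (t + + 1 + N) (t + + 1) + ι β)
        (dec-true (y ℤ.<? (t + + 1 + N))
          (lia 4 (λ t n y d → y :+ d :≡ t ⇒ :- n :≤ d ⇒ goal (y :< t :+ # 1 :+ n)) t N y (D y) fy≡t
          (D≥-N y))))

      R-above-right : ∀ t c → t + N ≤ c → R (c + + 1) t ≡ R c t + + 1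
      R-above-right t c ≤c = R-above c t
        (lia 4 (λ t n c d → t :+ n :≤ c ⇒ :- n :≤ d ⇒ goal (t :≤ c :+ d)) t N c (D c) ≤c (D≥-N c))

      -- When t grows by one, the new cut takes in one more pebble, which lands at t or later as no
      -- displacement is below - N; the new threshold loses the pebble headed for t.
      R-far-right₁ : ∀ t → R (t + N) t ≡ N
      R-far-right₁ t with ℤ.≤-total (+ 0) t
      ... | inj₁ 0≤t = ascend {λ t → R (t + N) t ≡ N} (+ 0) R-far-right₀ (λ t _ → up t) t 0≤t
        where
        up : ∀ t → R (t + N) t ≡ N → R (t + + 1 + N) (t + + 1) ≡ N
        up t IH = lia 4 (λ a b d n → a :≡ n ⇒ b :≡ a :+ # 1 ⇒ b :≡ d :+ # 1 ⇒ goal (d :≡ n))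
          (R (t + N) t) (R (t + + 1 + N) t) (R (t + + 1 + N) (t + + 1)) N IH
          (trans (cong (λ c → R c t) (lia 2 (λ t n → goal (t :+ # 1 :+ n :≡ t :+ n :+ # 1)) t N))
            (R-above-right t (t + N) ℤ.≤-refl))
          (R-raise-right t)
      ... | inj₂ t≤0 = descend {λ t → R (t + N) t ≡ N} (+ 0) R-far-right₀ (λ t _ → down t) t t≤0
        where
        down : ∀ t → R (t + + 1 + N) (t + + 1) ≡ N → R (t + N) t ≡ N
        down t IH = lia 4 (λ a b d n → d :≡ n ⇒ b :≡ a :+ # 1 ⇒ b :≡ d :+ # 1 ⇒ goal (a :≡ n))
          (R (t + N) t) (R (t + + 1 + N) t) (R (t + + 1 + N) (t + + 1)) N IH
          (trans (cong (λ c → R c t) (lia 2 (λ t n → goal (t :+ # 1 :+ n :≡ t :+ n :+ # 1)) t N))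
            (R-above-right t (t + N) ℤ.≤-refl))
          (R-raise-right t)

      R-far-right : ∀ t c → t + N ≤ c → R c t ≡ c - t
      R-far-right t = ascend {λ c → R c t ≡ c - t} (t + N)
        (trans (R-far-right₁ t) (lia 2 (λ t n → goal (n :≡ t :+ n :- t)) t N))
        (λ c ≤c IH → trans (R-above-right t c ≤c)
          (lia 3 (λ r c t → r :≡ c :- t ⇒ goal (r :+ # 1 :≡ c :+ # 1 :- t)) (R c t) c t IH))

      -- Since R grows by at most 1 with c, the difference R c t - (c - t) never increases, and it
      -- is 0 from t + N on.
      R≥c-t : ∀ c t → c - t ≤ R c t
      R≥c-t c t with ℤ.≤-total (t + N) c
      ... | inj₁ ≤c = ℤ.≤-reflexive (sym (R-far-right t c ≤c))
      ... | inj₂ c≤ = descend {λ c → c - t ≤ R c t} (t + N)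
        (ℤ.≤-reflexive (sym (R-far-right t (t + N) ℤ.≤-refl))) (λ c _ → down c) c c≤
        where
        down : ∀ c → c + + 1 - t ≤ R (c + + 1) t → c - t ≤ R c t
        down c IH with t ℤ.≤? f c
        ... | yes t≤ = lia 4 (λ r r′ c t → c :+ # 1 :- t :≤ r′ ⇒ r′ :≡ r :+ # 1 ⇒ goal (c :- t :≤ r))
          (R c t) (R (c + + 1) t) c t IH (R-above c t t≤)
        ... | no t≰ = lia 4 (λ r r′ c t → c :+ # 1 :- t :≤ r′ ⇒ r′ :≡ r ⇒ goal (c :- t :≤ r)) (R c t)
          (R (c + + 1) t) c t IH (R-below c t (ℤ.≰⇒> t≰))

      R-existsBelow : ∀ c t → c - t < R c t → ∃ λ z → c ≤ z × f z < t
      R-existsBelow c t lt with ℤ.≤-total (t + N) c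
      ... | inj₁ ≤c = contradiction lt (ℤ.<-irrefl (sym (R-far-right t c ≤c)))
      ... | inj₂ c≤ = descend {λ c → c - t < R c t → ∃ λ z → c ≤ z × f z < t} (t + N)
          (λ lt → contradiction lt (ℤ.<-irrefl (sym (R-far-right t (t + N) ℤ.≤-refl))))
            (λ c _ → down c) c c≤ lt
        where
        down : ∀ c → (c + + 1 - t < R (c + + 1) t → ∃ λ z → c + + 1 ≤ z × f z < t) → c - t < R c t → ∃ λ z →
          c ≤ z × f z < t
        down c IH lt with t ℤ.≤? f c
        ... | no t≰ = c , ℤ.≤-refl , ℤ.≰⇒> t≰
        ... | yes t≤ with IH
          (lia 4 (λ r r′ c t → c :- t :< r ⇒ r′ :≡ r :+ # 1 ⇒ goal (c :+ # 1 :- t :< r′)) (R c t)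
          (R (c + + 1) t) c t lt (R-above c t t≤))
        ... | z , c+1≤z , fz<t = z , ℤ.≤-trans (ℤ.i≤i+j c (+ 1)) c+1≤z , fz<t

      system : System
      system = record
        { D = D ; R = R ; periodic = D-periodic ; injective = f-injective
        ; above = R-above ; below = R-below ; R≥0 = R≥0 ; R≥c-t = R≥c-t
        ; R-antitone = λ c t → let y , eq = f-surjective t in
            lia 3 (λ r r′ i → r :≡ r′ :+ i ⇒ # 0 :≤ i ⇒ goal (r′ :≤ r)) (R c t) (R c (t + + 1))
              (ι (does (y ℤ.<? c)))
              (R-raise t y eq c) (proj₁ (ι-bounds (does (y ℤ.<? c))))
        ; R-slow = λ c t → let y , eq = f-surjective t in
            lia 3 (λ r r′ i → r :≡ r′ :+ i ⇒ i :≤ # 1 ⇒ goal (r :≤ r′ :+ # 1)) (R c t) (R c (t + + 1))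
              (ι (does (y ℤ.<? c)))
              (R-raise t y eq c) (proj₂ (ι-bounds (does (y ℤ.<? c))))
        ; existsAbove = R-existsAbove ; existsBelow = R-existsBelow
        }

      height : Height f R
      height = record { above = R-above ; below = R-below ; R≥0 = R≥0 ; R≥c-t = R≥c-t }

<-extend : ∀ {P : ℕ → Set} {k} → (∀ j → j ℕ.< k → P j) → P k → ∀ j → j ℕ.< suc k → P j
<-extend {P} all pk j j<1+k with ℕ.m≤n⇒m<n∨m≡n (ℕ.≤-pred j<1+k)
... | inj₁ j<k = all j j<k
... | inj₂ refl = pk

set : ∀ {n} → (Fin n → Bool) → Fin n → Bool → Fin n → Bool
set b i x v = if does (v Fin.≟ i) then x else b v

set-same : ∀ {n} (b : Fin n → Bool) i x → set b i x i ≡ x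
set-same b i x rewrite dec-true (i Fin.≟ i) refl = refl

set-other : ∀ {n} (b : Fin n → Bool) i x {v} → v ≢ i → set b i x v ≡ b v
set-other b i x {v} v≢i rewrite dec-false (v Fin.≟ i) v≢i = refl

-- The choice of a lift

module Selection (m : ℕ) (even : 2 ∣ suc m) (π : Permutation′ (suc m)) where
  private n = suc m
  open Residues n
  open Routing m even
  open Lifting m even π

  toℕ-cls : ∀ {j} → j ℕ.< n → toℕ (cls (+ j)) ≡ j
  toℕ-cls {j} j<n = residue-unique (Fin.toℕ<n _) j<n (pos-cls (+ j))

  count-set : ∀ b i x → count (set b i x) + ι (b i) ≡ count b + ι x
  count-set b i x = subst₂ (λ β β′ → count (set b i x) + ι β ≡ count b + ι β′)
    (cong b (cls-pos i)) (trans (cong (set b i x) (cls-pos i)) (set-same b i x))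
    (Σ<-update n (toℕ i) (Fin.toℕ<n i)
      (λ j j<n j≢i → cong ι (set-other b i x (λ eq → j≢i (trans (sym (toℕ-cls j<n)) (cong toℕ eq))))))

  -- The preference for odd vertices serves the rotations by 2, …, n - 2: all
  -- their pebbles have the same e.
  key : Fin n → ℤ
  key v = e v + e v + ι (odd (pos v))

  -- Halving the keys gives e v ≤ e u when the pebble of u is sent backwards and that of v forwards.
  -- This bounds the spread of D by N.
  Upper : (Fin n → Bool) → Set
  Upper b = ∀ u v → b u ≡ true → b v ≡ false → key v ≤ key u

  key-maximal : ∀ (b : Fin n → Bool) k → (∀ j → j ℕ.< k → b (cls (+ j)) ≡ true) ⊎
    ∃ λ i → b i ≡ false × ∀ j → j ℕ.< k → b (cls (+ j)) ≡ false → key (cls (+ j)) ≤ key i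
  key-maximal b zero = inj₁ (λ _ ())
  key-maximal b (suc k) with key-maximal b k | b (cls (+ k)) in bk
  ... | inj₁ all | true = inj₁ (<-extend all bk)
  ... | inj₁ all | false = inj₂ (cls (+ k) , bk , <-extend
    (λ j j<k bj → contradiction (trans (sym bj) (all j j<k)) (λ ())) (λ _ → ℤ.≤-refl))
  ... | inj₂ (i , bi , max) | true = inj₂ (i , bi , <-extend max
    (λ bj → contradiction (trans (sym bj) bk) (λ ())))
  ... | inj₂ (i , bi , max) | false with ℤ.≤-total (key i) (key (cls (+ k)))
  ... | inj₁ i≤k = inj₂
    (cls (+ k) , bk , <-extend (λ j j<k bj → ℤ.≤-trans (max j j<k bj) i≤k) (λ _ → ℤ.≤-refl))
  ... | inj₂ k≤i = inj₂ (i , bi , <-extend max (λ _ → k≤i))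

  select : ∀ l → l ℕ.≤ n → ∃ λ b → count b ≡ + l × Upper b
  select zero _ = (λ _ → false) , zeros n , λ _ _ ()
    where
    zeros : ∀ k → Σ< k (λ _ → + 0) ≡ + 0
    zeros zero = refl
    zeros (suc k) rewrite zeros k = refl
  select (suc l) l<n with select l (ℕ.<⇒≤ l<n)
  ... | b , count≡ , upper with key-maximal b n
  ... | inj₁ all = contradiction l<n (ℕ.<-irrefl (ℤ.+-injective
    (trans (sym count≡) (trans (Σ<-cong n (λ j j<n → cong ι (all j j<n))) (Σ<-1 n)))))
  ... | inj₂ (i , bi , max) = set b i true ,
    trans (lia 3 (λ s c l → s :+ # 0 :≡ c :+ # 1 ⇒ c :≡ l ⇒ goal (s :≡ # 1 :+ l)) (count (set b i true))
      (count b) (+ l)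
      (subst (λ β → count (set b i true) + ι β ≡ count b + + 1) bi (count-set b i true)) count≡) refl ,
    upper′
    where
    maximal : ∀ v → b v ≡ false → key v ≤ key i
    maximal v bv = subst (λ v → b v ≡ false → key v ≤ key i) (cls-pos v) (max (toℕ v) (Fin.toℕ<n v)) bv
    upper′ : Upper (set b i true)
    upper′ u v bu bv with v Fin.≟ i | u Fin.≟ i
    ... | no v≢i | yes refl = maximal v bv
    ... | no v≢i | no u≢i = upper u v bu bv

  count-ℕ : ∀ k (b : ℕ → Bool) → ∃ λ l → l ℕ.≤ k × Σ< k (λ j → ι (b j)) ≡ + l
  count-ℕ zero b = 0 , ℕ.z≤n , refl
  count-ℕ (suc k) b with count-ℕ k b | b k
  ... | l , l≤k , eq | true = suc l , ℕ.s≤s l≤k , trans (cong (_+ + 1) eq) (cong +_ (ℕ.+-comm l 1))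
  ... | l , l≤k , eq | false = l , ℕ.m≤n⇒m≤1+n l≤k , trans (cong (_+ + 0) eq) (ℤ.+-identityʳ (+ l))

  balanced-upper : ∃ λ b → count b ≡ count wraps × Upper b
  balanced-upper =
    let l , l≤n , eq = count-ℕ n (λ j → wraps (cls (+ j))) ; b , count≡ , upper = select l l≤n in
    b , trans count≡ (sym eq) , upper

  -- Meant for i going forwards and j backwards: their directions are reversed and the total
  -- displacement stays 0.
  exchange : (Fin n → Bool) → Fin n → Fin n → Fin n → Bool
  exchange b i j = set (set b i true) j false

  count-exchange : ∀ b {i j} → b i ≡ false → b j ≡ true → count (exchange b i j) ≡ count b
  count-exchange b {i} {j} bi bj = lia 3
    (λ s s′ c → s′ :+ # 1 :≡ s :+ # 0 ⇒ s :+ # 0 :≡ c :+ # 1 ⇒ goal (s′ :≡ c))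
    (count (set b i true)) (count (exchange b i j)) (count b)
    (subst (λ β → count (exchange b i j) + ι β ≡ count (set b i true) + + 0)
      (trans (set-other b i true j≢i) bj) (count-set (set b i true) j false))
    (subst (λ β → count (set b i true) + ι β ≡ count b + + 1) bi (count-set b i true))
    where
    j≢i : j ≢ i
    j≢i refl with () ← trans (sym bi) bj

-- Contradiction for all other permutations

module NonRotation (k : ℕ) (6≤n : 6 ℕ.≤ 3 ℕ.+ k) (even : 2 ∣ 3 ℕ.+ k) (π : Permutation′ (3 ℕ.+ k))
  (¬routable : ¬ RoutableIn π (suc k))
  (¬next : ¬ (∀ i → π ⟨$⟩ʳ i ≡ next i)) (¬prev : ¬ (∀ i → π ⟨$⟩ʳ i ≡ prev i)) where

  private n = 3 ℕ.+ k
  open Residues n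
  open Routing (2 ℕ.+ k) even
  open Lifting (2 ℕ.+ k) even π
  open Selection (2 ℕ.+ k) even π

  open Displacement using () renaming (system to systemOf)

  6≤N : + 6 ≤ N
  6≤N = +≤+ 6≤n

  module _ (b : Fin n → Bool) (balanced : count b ≡ count wraps) where
    open Displacement b
    open System (system balanced) using (Tight)

    tight-exists : ∀ α → ¬
      (∀ c p q → active α c ≡ false → + 0 < p → + 0 < q → N ≤ p + q + + 1 → ¬ Tight c p q)
    tight-exists α none = ¬routable
      (routable π f R f-periodic f-destination-pos (height balanced) k α bounded)
      where
      s = + suc k
      bounded : Bounded s α R
      bounded c t inactive lo hi with (R c t + R c t - (c - t)) ℤ.≤? s
      ... | yes ≤s = ≤s
      -- With q = R c t and p = R c t - (c - t), twice these numbers are H c t plus and minus c - t.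
      -- Both are positive because H c t > n - 2 inside the window; outside it, H could be large
      -- with all pebbles passing in one direction.
      ... | no ≰s = ⊥-elim (none c (R c t + t - c) (R c t) inactive
        (lia 4 (λ r c t s → s :< r :+ r :- (c :- t) ⇒ c :≤ t :+ s ⇒ goal (# 0 :< r :+ t :- c)) (R c t) c t s
          (ℤ.≰⇒> ≰s) hi)
        (lia 4 (λ r c t s → s :< r :+ r :- (c :- t) ⇒ t :- s :≤ c ⇒ goal (# 0 :< r)) (R c t) c t s
          (ℤ.≰⇒> ≰s) lo)
        (lia 4 (λ r c t s → s :< r :+ r :- (c :- t) ⇒ goal (# 2 :+ s :≤ r :+ t :- c :+ r :+ # 1))
          (R c t) c t s (ℤ.≰⇒> ≰s))
        (cong (R c) (lia 3 (λ r c t → goal (c :+ (r :+ t :- c) :- r :≡ t)) (R c t) c t)))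

    -- The phase `true` fails at an even cut and the phase `false` at an odd one. As N is even, they
    -- stay different modulo N, even after a shift by 2.
    tight-two-exist : ¬ (∀ c p q c′ p′ q′ →
      + 0 < p → + 0 < q → N ≤ p + q + + 1 → Tight c p q →
      + 0 < p′ → + 0 < q′ → N ≤ p′ + q′ + + 1 → Tight c′ p′ q′ →
      ¬ c′ ∼ c → ¬ c′ ∼ c + + 2 → ¬ c ∼ c′ + + 2 → ⊥)
    tight-two-exist none = tight-exists true λ c p q inactive 0<p 0<q N≤ tight →
      tight-exists false λ c′ p′ q′ inactive′ 0<p′ 0<q′ N≤′ tight′ →
        none c p q c′ p′ q′ 0<p 0<q N≤ tight 0<p′ 0<q′ N≤′ tight′
          (λ c′∼c → different c c′ inactive inactive′ (odd-∼ c′∼c))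
          (λ c′∼c → different c c′ inactive inactive′ (trans (odd-∼ c′∼c) (odd+2 c)))
          (λ c∼c′ → different c c′ inactive inactive′ (sym (trans (odd-∼ c∼c′) (odd+2 c′))))
      where
      odd+2 : ∀ c → odd (c + + 2) ≡ odd c
      odd+2 c = trans (cong odd (lia 1 (λ c → goal (c :+ # 2 :≡ c :+ # 1 :+ # 1)) c))
        (trans (odd-suc (c + + 1)) (trans (cong not (odd-suc c)) (not-involutive (odd c))))
      different : ∀ x y → odd x ≡ false → not (odd y) ≡ false → odd y ≢ odd x
      different x y x-even y-odd same with () ← trans (sym y-odd) (cong not (trans same x-even))

    not-narrow : ¬ (∀ x y → D x < D y + N)
    not-narrow narrow = tight-two-exist λ c p q c′ p′ q′ 0<p 0<q N≤ tight 0<p′ 0<q′ N≤′ tight′ c′≁c _ _ →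
      c′≁c (tight-unique-narrow
        (system balanced) {c} {c′} {p} {q} {p′} {q′} narrow 0<p 0<q 0<p′ 0<q′ N≤ N≤′ tight tight′)

    module _ (M : ℤ) (upper : ∀ x → D x ≤ M) (lower : ∀ x → M - N ≤ D x) where
      open Wide (system balanced) M upper lower using (Extreme)

      not-uninterlocked : ¬ (∀ x → Extreme x) → ¬ ¬ Interlocked (system balanced) M upper lower
      not-uninterlocked ¬extreme ¬interlocked = tight-two-exist
        λ c p q c′ p′ q′ 0<p 0<q N≤ tight 0<p′ 0<q′ N≤′ tight′ c′≁c c′≁c+2 c≁c′+2 →
          ¬interlocked (tight-two⇒interlocked (system balanced) M upper lower {c} {p} {q} {c′} {p′} {q′}
            6≤N ¬extreme 0<p 0<q N≤ tight 0<p′ 0<q′ N≤′ tight′ c′≁c c′≁c+2 c≁c′+2)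

  module _ {M : ℤ} (0≤M : + 0 ≤ M) (M<N : M < N) where

    -- The displacements M and M - N both come from the forward distance e v = M, and only the
    -- direction differs. This is why such pebbles can trade displacements.
    decode-upper : ∀ v β → e v - scale β ≡ M → β ≡ false × e v ≡ M
    decode-upper v true eq = ⊥-elim
      (lia 3 (λ e m n → e :- n :≡ m ⇒ e :< n ⇒ # 0 :≤ m ⇒ goal absurd) (e v) M N eq (e<N v) 0≤M)
    decode-upper v false eq = refl , lia 2 (λ e m → e :- # 0 :≡ m ⇒ goal (e :≡ m)) (e v) M eq

    decode-lower : ∀ v β → e v - scale β ≡ M - N → β ≡ true × e v ≡ M
    decode-lower v true eq = refl , lia 3 (λ e m n → e :- n :≡ m :- n ⇒ goal (e :≡ m)) (e v) M N eq
    decode-lower v false eq = ⊥-elim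
      (lia 3 (λ e m n → e :- # 0 :≡ m :- n ⇒ m :< n ⇒ # 0 :≤ e ⇒ goal absurd) (e v) M N eq M<N (e≥0 v))

  -- If the configuration is interlocked, the pebbles on the two sides of `gap` trade displacements.
  -- The result has the same bounds and is not extreme either, so it would be interlocked again, but
  -- the trade has created a drop. The double negation avoids deciding a statement about all of ℤ,
  -- and the final goal is ⊥ anyway.
  wide-not-nonextreme : ∀ b (balanced : count b ≡ count wraps) M
    (upper : ∀ x → Displacement.D b x ≤ M) (lower : ∀ x → M - N ≤ Displacement.D b x) →
    + 0 ≤ M → M < N → ¬ ¬ (∀ x → Wide.Extreme (systemOf b balanced) M upper lower x)
  wide-not-nonextreme b balanced M upper lower 0≤M M<N ¬extreme =
    not-uninterlocked b balanced M upper lower ¬extreme exchanged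
    where
    open Displacement b
    exchanged : ¬ Interlocked (systemOf b balanced) M upper lower
    exchanged I = not-uninterlocked b′ balanced′ M upper′ lower′ ¬extreme′ λ I′ → [ left I′ ,
      right I′ ]′ long
      where
      open Interlocked I
      i = cls (gap - + 1)
      j = cls (gap + + 1)
      bi : b i ≡ false
      bi = proj₁ (decode-upper 0≤M M<N i (b i) before)
      bj : b j ≡ true
      bj = proj₁ (decode-lower 0≤M M<N j (b j) after)
      b′ = exchange b i j
      balanced′ = trans (count-exchange b bi bj) balanced
      module E = Displacement b′
      i≢j : i ≢ j
      i≢j i≡j = contradiction (trans (sym bi) (trans (cong b i≡j) bj)) (λ ())

      D-cls : ∀ {x y} → cls x ≡ cls y → D x ≡ D y
      D-cls eq = cong (λ v → e v - scale (b v)) eq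

      at-j : ∀ x → cls x ≡ j → E.D x ≡ M
      at-j x eq = trans (cong (λ v → e v - scale (b′ v)) eq)
        (trans (cong (λ β → e j - scale β) (set-same (set b i true) j false))
        (lia 2 (λ e m → e :≡ m ⇒ goal (e :- # 0 :≡ m)) (e j) M
          (proj₂ (decode-lower 0≤M M<N j (b j) after))))
      at-i : ∀ x → cls x ≡ i → E.D x ≡ M - N
      at-i x eq = trans (cong (λ v → e v - scale (b′ v)) eq) (trans (cong (λ β → e i - scale β)
          (trans (set-other (set b i true) j false i≢j) (set-same b i true)))
        (cong (_- N) (proj₂ (decode-upper 0≤M M<N i (b i) before))))
      elsewhere : ∀ x → cls x ≢ i → cls x ≢ j → E.D x ≡ D x
      elsewhere x ≢i ≢j = cong (λ β → e (cls x) - scale β)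
        (trans (set-other (set b i true) j false ≢j) (set-other b i true ≢i))

      compare : ∀ x → (E.D x ≡ M × D x ≡ M - N) ⊎ (E.D x ≡ M - N × D x ≡ M) ⊎ E.D x ≡ D x
      compare x = by-cases (cls x Fin.≟ j) (cls x Fin.≟ i)
        where
        by-cases : Dec (cls x ≡ j) → Dec (cls x ≡ i) →
          (E.D x ≡ M × D x ≡ M - N) ⊎ (E.D x ≡ M - N × D x ≡ M) ⊎ E.D x ≡ D x
        by-cases (yes x≡j) _ = inj₁ (at-j x x≡j , trans (D-cls {x} {gap + + 1} x≡j) after)
        by-cases (no _) (yes x≡i) = inj₂ (inj₁ (at-i x x≡i , trans (D-cls {x} {gap - + 1} x≡i) before))
        by-cases (no x≢j) (no x≢i) = inj₂ (inj₂ (elsewhere x x≢i x≢j))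

      upper′ : ∀ x → E.D x ≤ M
      upper′ x with compare x
      ... | inj₁ (eq , _) = ℤ.≤-reflexive eq
      ... | inj₂ (inj₁ (eq , _)) = subst (_≤ M) (sym eq)
        (lia 2 (λ m n → # 6 :≤ n ⇒ goal (m :- n :≤ m)) M N 6≤N)
      ... | inj₂ (inj₂ eq) = subst (_≤ M) (sym eq) (upper x)

      lower′ : ∀ x → M - N ≤ E.D x
      lower′ x with compare x
      ... | inj₁ (eq , _) = subst (M - N ≤_) (sym eq)
        (lia 2 (λ m n → # 6 :≤ n ⇒ goal (m :- n :≤ m)) M N 6≤N)
      ... | inj₂ (inj₁ (eq , _)) = ℤ.≤-reflexive (sym eq)
      ... | inj₂ (inj₂ eq) = subst (M - N ≤_) (sym eq) (lower x)

      ¬extreme′ : ¬ (∀ x → Wide.Extreme (systemOf b′ balanced′) M upper′ lower′ x)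
      ¬extreme′ extreme′ = ¬extreme λ x → original x (compare x) (extreme′ x)
        where
        original : ∀ x → (E.D x ≡ M × D x ≡ M - N) ⊎ (E.D x ≡ M - N × D x ≡ M) ⊎ E.D x ≡ D x →
          E.D x ≡ M ⊎ E.D x ≡ M - N → D x ≡ M ⊎ D x ≡ M - N
        original x (inj₁ (_ , eq)) _ = inj₂ eq
        original x (inj₂ (inj₁ (_ , eq))) _ = inj₁ eq
        original x (inj₂ (inj₂ eq)) (inj₁ eq′) = inj₁ (trans (sym eq) eq′)
        original x (inj₂ (inj₂ eq)) (inj₂ eq′) = inj₂ (trans (sym eq) eq′)

      odd-cls : ∀ {x y} → cls x ≡ cls y → odd x ≡ odd y
      odd-cls {x} {y} eq = trans (sym (odd-∼ (pos-cls x)))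
        (trans (cong (λ v → odd (pos v)) eq) (odd-∼ (pos-cls y)))

      odd≢suc : ∀ x → odd (x + + 1) ≢ odd x
      odd≢suc x same with odd x | odd (x + + 1) | odd-suc x
      odd≢suc x refl | true | .true | ()
      odd≢suc x refl | false | .false | ()

      -- After the trade gap - 1 carries M - N; if gap - 2 carried M, it still does, and the two
      -- form a forbidden drop.
      left : Interlocked (systemOf b′ balanced′) M upper′ lower′ → D (gap - + 1 - + 1) ≢ M
      left I′ eq = Interlocked.no-drop I′ x still (at-i (x + + 1) (cong cls (-1+1 (gap - + 1))))
        where
        x = gap - + 1 - + 1
        x≢i : cls x ≢ i
        x≢i x≡i = odd≢suc x (trans (cong odd (-1+1 (gap - + 1))) (sym (odd-cls {x} {gap - + 1} x≡i)))
        still : E.D x ≡ M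
        -- Should x be in the class of j, it carries M after the trade as well, so these classes are
        -- not separated. That x is not in the class of i follows from parity.
        still = [ at-j x , (λ x≢j → trans (elsewhere x x≢i x≢j) eq) ]′ (toSum (cls x Fin.≟ j))

      right : Interlocked (systemOf b′ balanced′) M upper′ lower′ → D (gap + + 1 + + 1) ≢ M - N
      right I′ eq = Interlocked.no-drop I′ (gap + + 1) (at-j (gap + + 1) refl) still
        where
        x = gap + + 1 + + 1
        x≢j : cls x ≢ j
        x≢j x≡j = odd≢suc (gap + + 1) (odd-cls {x} {gap + + 1} x≡j)
        still : E.D x ≡ M - N
        still = [ at-i x , (λ x≢i → trans (elsewhere x x≢i x≢j) eq) ]′ (toSum (cls x Fin.≟ i))

  not-extreme : ∀ b (balanced : count b ≡ count wraps) → Upper b → ∀ M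
    (upper : ∀ x → Displacement.D b x ≤ M) (lower : ∀ x → M - N ≤ Displacement.D b x) →
    + 0 < M → M < N → ¬ (∀ x → Wide.Extreme (systemOf b balanced) M upper lower x)
  not-extreme b balanced preferred M upper lower 0<M M<N extreme = cases
    where
    open Displacement b
    f∼ : ∀ x → f x ∼ x + M
    f∼ x with extreme x
    ... | inj₁ eq = ≡⇒∼ (cong (_+_ x) eq)
    ... | inj₂ eq = multiple (- + 1)
      (trans (cong (_+_ x) eq) (trans (sym (ℤ.+-assoc x M (- N))) (cong (_+_ (x + M)) (sym (ℤ.-1*i≡-i N)))))

    target : ∀ {y} v → pos v + M ∼ y → pos (π ⟨$⟩ʳ v) ∼ y
    target v M∼y = ∼-trans (∼-sym (f-destination-pos v)) (∼-trans (f∼ (pos v)) M∼y)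

    -- Both pebbles have forward distance M, so their keys are 2 M + 1 and 2 M: the odd vertex would
    -- have been sent backwards before the even one.
    inverted : ∀ u v → odd u ≡ true → odd v ≡ false → D u ≡ M → D v ≢ M - N
    inverted u v u-odd v-even Du Dv = lia 3
      (λ eu ev m → eu :≡ m ⇒ ev :≡ m ⇒ eu :+ eu :+ # 1 :≤ ev :+ ev :+ # 0 ⇒ goal absurd)
      (e (cls u)) (e (cls v)) M (proj₂ at-u) (proj₂ at-v)
      (subst₂ (λ β γ → e (cls u) + e (cls u) + ι β ≤ e (cls v) + e (cls v) + ι γ)
        (trans (odd-∼ (pos-cls u)) u-odd) (trans (odd-∼ (pos-cls v)) v-even)
        (preferred (cls v) (cls u) (proj₁ at-v) (proj₁ at-u)))
      where
      at-u = decode-upper (ℤ.<⇒≤ 0<M) M<N (cls u) (b (cls u)) Du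
      at-v = decode-lower (ℤ.<⇒≤ 0<M) M<N (cls v) (b (cls v)) Dv

    cases : ⊥
    cases with + 1 ℤ.≟ M | M + + 1 ℤ.≟ N
    ... | yes refl | _ = ¬next (λ v → pos-injective (target v (∼-sym (pos-next v))))
    ... | no _ | yes M+1≡N = ¬prev (λ v → pos-injective (target v (∼-trans
      (multiple (+ 1) (trans
        (lia 3 (λ v m n → m :+ # 1 :≡ n ⇒ goal (v :+ m :≡ v :- # 1 :+ n)) (pos v) M N M+1≡N)
        (cong (_+_ (pos v - + 1)) (sym (ℤ.*-identityˡ N))))) (∼-sym (pos-prev v)))))
    ... | no 1≢M | no M+1≢N = tight-exists b balanced true λ c p q c-even 0<p 0<q N≤ tight →
      impossible c c-even (tight⇒drop (systemOf b balanced) M upper lower {c} {p} {q} extreme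
        (ℤ.≤∧≢⇒< (ℤ.i<j⇒suc[i]≤j 0<M) 1≢M)
          (ℤ.≤∧≢⇒< (lia 2 (λ m n → m :< n ⇒ goal (m :+ # 1 :≤ n)) M N M<N) M+1≢N)
        0<p 0<q N≤ tight)
      where
      odd-pred : ∀ c → odd (c - + 1) ≡ not (odd c)
      odd-pred = active-pred true
      -- In each case a forward pebble at an odd vertex meets a backward one at an even vertex. A
      -- drop at c has them at c - 1 and c. Around the odd cuts c - 1 and c + 1 the neighbours have
      -- the wrong parity, and the outer vertices of `Full` are used.
      impossible : ∀ c → odd c ≡ false → ¬ ((D (c - + 1) ≡ M × D c ≡ M - N) ⊎
        Full (systemOf b balanced) M upper lower (c - + 1) ⊎ Full (systemOf b balanced) M upper lower
          (c + + 1))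
      impossible c c-even (inj₁ (high , low)) = inverted (c - + 1) c
        (trans (odd-pred c) (cong not c-even)) c-even high low
      impossible c c-even (inj₂ (inj₁ (high , _ , _ , low))) = inverted (c - + 1 - + 1 - + 1)
        (c - + 1 + + 1)
        (trans (odd-pred (c - + 1 - + 1))
          (cong not (trans (odd-pred (c - + 1)) (cong not (trans (odd-pred c) (cong not c-even))))))
        (trans (cong odd (-1+1 c)) c-even) high low
      impossible c c-even (inj₂ (inj₂ (high , _ , _ , low))) = inverted (c + + 1 - + 1 - + 1)
        (c + + 1 + + 1)
        (trans (odd-pred (c + + 1 - + 1)) (cong not (trans (cong odd (+1-1 c)) c-even)))
        (trans (odd-suc (c + + 1)) (cong not (trans (odd-suc c) (cong not c-even)))) high low

  impossible : ⊥
  impossible = not-narrow b balanced λ x y → ℤ.≤∧≢⇒< (spread x y) (not-wide x y)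
    where
    b = proj₁ balanced-upper
    balanced = proj₁ (proj₂ balanced-upper)
    preferred = proj₂ (proj₂ balanced-upper)
    open Displacement b
    ι-odd : ∀ v → + 0 ≤ ι (odd (pos v)) × ι (odd (pos v)) ≤ + 1
    ι-odd v = ι-bounds (odd (pos v))
    spread : ∀ x y → D x ≤ D y + N
    spread x y with b (cls x) in bx | b (cls y) in by
    ... | true | true = lia 3 (λ a c n → a :< n ⇒ # 0 :≤ c ⇒ goal (a :- n :≤ c :- n :+ n))
      (e (cls x)) (e (cls y)) N (e<N (cls x)) (e≥0 (cls y))
    ... | true | false = lia 3 (λ a c n → a :< n ⇒ # 0 :≤ c ⇒ # 0 :≤ n ⇒ goal (a :- n :≤ c :- # 0 :+ n))
      (e (cls x)) (e (cls y)) N (e<N (cls x)) (e≥0 (cls y)) (+≤+ ℕ.z≤n)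
    ... | false | false = lia 3 (λ a c n → a :< n ⇒ # 0 :≤ c ⇒ goal (a :- # 0 :≤ c :- # 0 :+ n))
      (e (cls x)) (e (cls y)) N (e<N (cls x)) (e≥0 (cls y))
    ... | false | true = lia 5
      (λ a c n i j → a :+ a :+ i :≤ c :+ c :+ j ⇒ # 0 :≤ i ⇒ j :≤ # 1 ⇒ goal (a :- # 0 :≤ c :- n :+ n))
      (e (cls x)) (e (cls y)) N (ι (odd (pos (cls x)))) (ι (odd (pos (cls y))))
      (preferred (cls y) (cls x) by bx) (proj₁ (ι-odd (cls x))) (proj₂ (ι-odd (cls y)))
    not-wide : ∀ x y → D x ≢ D y + N
    not-wide x y Dx = wide-not-nonextreme b balanced (D x) upper lower 0≤M (D<N x)
      (not-extreme b balanced preferred (D x) upper lower (ℤ.≤∧≢⇒< 0≤M 0≢M) (D<N x))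
      where
      upper : ∀ z → D z ≤ D x
      upper z = subst (D z ≤_) (sym Dx) (spread z y)
      lower : ∀ z → D x - N ≤ D z
      lower z = lia 3 (λ a d n → a :≤ d :+ n ⇒ goal (a :- n :≤ d)) (D x) (D z) N (spread x z)
      0≤M : + 0 ≤ D x
      0≤M = lia 3 (λ a d n → a :≡ d :+ n ⇒ :- n :≤ d ⇒ goal (# 0 :≤ a)) (D x) (D y) N Dx (D≥-N y)
      0≢M : + 0 ≢ D x
      -- If M = 0, nothing travels to the right and `R y y` vanishes. The pebble at y travels N to
      -- the left, so `R (y + 1) y` vanishes too, against `R≥c-t`.
      0≢M 0≡M with + 0 ℤ.<? R y y
      ... | yes 0<R with R-existsAbove y y 0<R
      ... | z , z<y , y≤fz = lia 4 (λ z y d a → z :< y ⇒ y :≤ z :+ d ⇒ d :≤ a ⇒ # 0 :≡ a ⇒ goal absurd) z y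
        (D z) (D x) z<y y≤fz (upper z) 0≡M
      0≢M 0≡M | no 0≮R = lia 3 (λ r r′ y → r :≤ # 0 ⇒ r′ :≡ r ⇒ y :+ # 1 :- y :≤ r′ ⇒ goal absurd) (R y y)
        (R (y + + 1) y) y (ℤ.≮⇒≥ 0≮R)
        (R-below y y (lia 4 (λ y d a n → # 0 :≡ a ⇒ a :≡ d :+ n ⇒ # 6 :≤ n ⇒ goal (y :+ d :< y)) y (D y)
          (D x) N 0≡M Dx 6≤N))
        (R≥c-t balanced (y + + 1) y)

theorem2 : (n : ℕ) → 6 ℕ.≤ n → 2 ∣ n → (π : Permutation′ n) →
    rt[ π ]≡ (n ∸ 1) →
    (∀ i → π ⟨$⟩ʳ i ≡ next i) ⊎ (∀ i → π ⟨$⟩ʳ i ≡ prev i)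
theorem2 (suc (suc (suc k))) 6≤n@(ℕ.s≤s (ℕ.s≤s (ℕ.s≤s _))) even π (_ , minimal)
  with Fin.all? (λ i → (π ⟨$⟩ʳ i) Fin.≟ next i) | Fin.all? (λ i → (π ⟨$⟩ʳ i) Fin.≟ prev i)
... | yes is-next | _ = inj₁ is-next
... | no _ | yes is-prev = inj₂ is-prev
... | no ¬next | no ¬prev = ⊥-elim (NonRotation.impossible k 6≤n even π
  (λ r → ℕ.1+n≰n (minimal (suc k) r)) ¬next ¬prev)
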